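{- Let $D=(V,A)$ be a digraph with $n=|V|$ vertices. For each permutation $\sigma\in\mathfrak{S}_V$ set \[\varphi(\sigma):=\sum_{\substack{\gamma\text{ a cycle of }\sigma;\\ \gamma\text{ is a }D\text{ -cycle}}}\bigl(\ell(\gamma)-1\bigr).\] Then \[U_D=\sum_{\sigma\in\mathfrak{S}_V(D,\overline{D})}(-1)^{\varphi(\sigma)}\,p_{\operatorname{type}\sigma}.\]
   Context: A digraph is a pair $D=(V,A)$ with $V$ a finite set and $A\subseteq V\times V$ (loops allowed). Its complement is $\overline{D}=(V,(V\times V)\setminus A)$. A $V$-listing is a tuple $w=(w_1,\dots,w_n)$ containing each element of $V$ exactly once. For a $V$-listing $w$, $\operatorname{Des}(w,D)=\{i\in[n-1]:(w_i,w_{i+1})\in A\}$. For $I\subseteq[n-1]$, $L_{I,n}=\sum x_{i_1}x_{i_2}\cdots x_{i_n}$, the sum over all positive integers $i_1\le i_2\le\cdots\le i_n$ with $i_p<i_{p+1}$ for each $p\in I$. The Redei--Berge symmetric function is $U_D=\sum_{w}L_{\operatorname{Des}(w,D),n}$, summed over all $V$-listings $w$. Two nonempty tuples are rotation-equivalent if one is a cyclic rotation of the other. For $\sigma\in\mathfrak{S}_V$ (permutations of $V$), the cycles of $\sigma$ are the rotation-equivalence classes of the tuples $(i,\sigma(i),\dots,\sigma^{k-1}(i))$ with $i\in V$ and $k$ the least positive integer with $\sigma^k(i)=i$; the length $\ell(\gamma)$ of a class is the common length of its tuples; the cyclic arc set of the class of $(v_1,\dots,v_k)$ is $\operatorname{CArcs}\gamma=\{(v_1,v_2),\dots,(v_{k-1},v_k),(v_k,v_1)\}$.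 A $D$-cycle is a rotation-equivalence class $\gamma$ of nonempty tuples of distinct elements of $V$ with $\operatorname{CArcs}\gamma\subseteq A$ (similarly for $\overline{D}$-cycles). $\mathfrak{S}_V(D,\overline{D})$ is the set of $\sigma\in\mathfrak{S}_V$ each of whose cycles is a $D$-cycle or a $\overline{D}$-cycle. $\operatorname{type}\sigma$ is the partition whose entries are the lengths of the cycles of $\sigma$. $p_k=x_1^k+x_2^k+\cdots$ and $p_\lambda=p_{\lambda_1}p_{\lambda_2}\cdots p_{\lambda_m}$ for a partition $\lambda=(\lambda_1,\dots,\lambda_m)$. -}

module Defs where

open import Data.Bool using (Bool; true; false; if_then_else_; _∧_; _∨_; not)
open import Data.Nat as ℕ using (ℕ; zero; suc; pred; _≡ᵇ_; _≤ᵇ_; _<ᵇ_)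
open import Data.Fin using (Fin; zero; suc; toℕ; inject₁)
open import Data.List using (List; []; _∷_; map; concatMap; filter; length; foldr; lookup; upTo; allFin)
open import Data.Nat.ListAction using (sum)
open import Data.Integer as ℤ using (ℤ; +_; -1ℤ; 0ℤ)

all : ∀ {a} {X : Set a} → (X → Bool) → List X → Bool
all P = foldr (λ x b → P x ∧ b) true

_==_ : ∀ {n} → Fin n → Fin n → Bool
i == j = toℕ i ≡ᵇ toℕ j

allF : ∀ {n} → (Fin n → Bool) → Bool
allF {n} P = all P (allFin n)

countF : ∀ {n} → (Fin n → Bool) → ℕ
countF {n} P = length (filter (λ x → P x Data.Bool.≟ true) (allFin n))
  where import Data.Bool

consF : ∀ {n k} → Fin k → (Fin n → Fin k) → Fin (suc n) → Fin k
consF x f zero    = x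
consF x f (suc i) = f i

allFuns : (n k : ℕ) → List (Fin n → Fin k)
allFuns zero    k = (λ ()) ∷ []
allFuns (suc n) k = concatMap (λ f → map (λ x → consF x f) (allFin k)) (allFuns n k)

sumℤ : List ℤ → ℤ
sumℤ = foldr ℤ._+_ 0ℤ

Digraph : ℕ → Set
Digraph n = Fin n → Fin n → Bool

complement : ∀ {n} → Digraph n → Digraph n
complement A u v = not (A u v)

-- bijections Fin n → Fin n (for a finite set, injective = bijective)
isInjective : ∀ {n} → (Fin n → Fin n) → Bool
isInjective f = allF (λ i → allF (λ j → if f i == f j then i == j else true))

-- all V-listings w = (w_1,…,w_n), i.e. tuples containing each vertex exactly once,
-- encoded as w : Fin n → Fin n (position ↦ vertex); also used for 𝔖_V.
perms : (n : ℕ) → List (Fin n → Fin n)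
perms n = filter (λ f → isInjective f Data.Bool.≟ true) (allFuns n n)
  where import Data.Bool

-- Positions: [n-1] = {1,…,n-1} is encoded as Fin (pred n); p : Fin (pred n)
-- stands for the 1-based position p+1, with adjacent 0-based positions lo p, hi p.

lo : ∀ {n} → Fin (pred n) → Fin n
lo {suc m} p = inject₁ p

hi : ∀ {n} → Fin (pred n) → Fin n
hi {suc m} p = suc p

Des : ∀ {n} → (Fin n → Fin n) → Digraph n → Fin (pred n) → Bool
Des w A p = A (w (lo p)) (w (hi p))

-- Symmetric functions are compared coefficientwise.  A monomial is
-- x_1^{α_0} x_2^{α_1} ⋯ x_k^{α_(k-1)} with α : Fin k → ℕ (variable v : Fin k is x_{v+1});
-- every monomial arises this way for some k.

-- coefficient of x^α in L_{I,n}: number of sequences i_1 ≤ ⋯ ≤ i_n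
-- (encoded as s : Fin n → Fin k, since only variables x_1..x_k may occur),
-- strict at every p ∈ I, with x_{i_1}⋯x_{i_n} = x^α.
coeffL : (n : ℕ) → (Fin (pred n) → Bool) → (k : ℕ) → (Fin k → ℕ) → ℕ
coeffL n I k α = length (filter (λ s → ok s Data.Bool.≟ true) (allFuns n k))
  where
  import Data.Bool
  ok : (Fin n → Fin k) → Bool
  ok s = allF (λ p → (toℕ (s (lo p)) ≤ᵇ toℕ (s (hi p)))
                     ∧ (if I p then toℕ (s (lo p)) <ᵇ toℕ (s (hi p)) else true))
       ∧ allF (λ v → countF (λ i → s i == v) ≡ᵇ α v)

-- coefficient of x^α in p_λ = p_{λ_1} ⋯ p_{λ_m}: expanding the product, number of
-- choices c of a variable for each factor with ∏_j x_{c j}^{λ_j} = x^α.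
coeffP : List ℕ → (k : ℕ) → (Fin k → ℕ) → ℕ
coeffP λs k α = length (filter (λ c → ok c Data.Bool.≟ true) (allFuns (length λs) k))
  where
  import Data.Bool
  ok : (Fin (length λs) → Fin k) → Bool
  ok c = allF (λ v → sum (map (lookup λs) (filter (λ j → (c j == v) Data.Bool.≟ true) (allFin (length λs)))) ≡ᵇ α v)

-- Cycles of a permutation σ.  The cycle through i is represented by the tuple
-- (i, σ i, …, σ^{ℓ-1} i); each cycle (rotation class) is enumerated exactly once
-- via its unique representative i = the least element of its orbit.

iter : ∀ {n} → (Fin n → Fin n) → ℕ → Fin n → Fin n
iter σ zero    i = i
iter σ (suc m) i = σ (iter σ m i)

-- least k ≥ 1 with σ^k i = i (searched in 1..n, which suffices for permutations)
orbitLen : ∀ {n} → (Fin n → Fin n) → Fin n → ℕ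
orbitLen {n} σ i = search n 1
  where
  search : ℕ → ℕ → ℕ
  search zero    k = k
  search (suc f) k = if iter σ k i == i then k else search f (suc k)

orbit : ∀ {n} → (Fin n → Fin n) → Fin n → List (Fin n)
orbit σ i = map (λ m → iter σ m i) (upTo (orbitLen σ i))

isRep : ∀ {n} → (Fin n → Fin n) → Fin n → Bool
isRep σ i = all (λ j → toℕ i ≤ᵇ toℕ j) (orbit σ i)

cycleReps : ∀ {n} → (Fin n → Fin n) → List (Fin n)
cycleReps {n} σ = filter (λ i → isRep σ i Data.Bool.≟ true) (allFin n)
  where import Data.Bool

-- the cycle through i is a D-cycle: CArcs ⊆ A, i.e. (σ^m i, σ^{m+1} i) ∈ A for all m < ℓ
-- (the last arc is (σ^{ℓ-1} i, σ^ℓ i) = (v_ℓ, v_1)).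
isDCycle : ∀ {n} → Digraph n → (Fin n → Fin n) → Fin n → Bool
isDCycle A σ i = all (λ m → A (iter σ m i) (iter σ (suc m) i)) (upTo (orbitLen σ i))

inSDD : ∀ {n} → Digraph n → (Fin n → Fin n) → Bool
inSDD A σ = all (λ i → isDCycle A σ i ∨ isDCycle (complement A) σ i) (cycleReps σ)

φ : ∀ {n} → Digraph n → (Fin n → Fin n) → ℕ
φ A σ = sum (map (λ i → pred (orbitLen σ i))
                 (filter (λ i → isDCycle A σ i Data.Bool.≟ true) (cycleReps σ)))
  where import Data.Bool

-- type σ (as a list of cycle lengths; order is irrelevant for p_type)
cycleType : ∀ {n} → (Fin n → Fin n) → List ℕ
cycleType σ = map (orbitLen σ) (cycleReps σ)

coeffU : ∀ {n} → Digraph n → (k : ℕ) → (Fin k → ℕ) → ℤ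
coeffU {n} A k α = + sum (map (λ w → coeffL n (Des w A) k α) (perms n))

coeffRHS : ∀ {n} → Digraph n → (k : ℕ) → (Fin k → ℕ) → ℤ
coeffRHS {n} A k α =
  sumℤ (map (λ σ → (-1ℤ ℤ.^ φ A σ) ℤ.* (+ coeffP (cycleType σ) k α))
            (filter (λ σ → inSDD A σ Data.Bool.≟ true) (perms n)))
  where import Data.Bool

{-# OPTIONS --safe #-}

-- Expanding both sides over all colourings f : V → {1,…,k} with content α reduces the
-- theorem to one digraph "twist A f" per colouring: keep the arcs of A inside colour classes,
-- and add all arcs from a colour to a smaller one.  On the left, listings together with a compatible
-- sequence become listings without consecutive arcs of twist A f.  On the right, a cycle on which f is
-- not constant goes both up and down, so it is neither a cycle of twist A f nor of its complement.
--
-- What remains is that, for every digraph A, the number of listings avoiding A equals the sum of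
-- (-1)^φ(σ) over 𝔖(D, D̄).  Both sides, as functions X of A, satisfy the recursion
--   X(A) = X(A′) + Σ_u [(u,0) ∉ A] X(A′ with row u emptied) − Σ_v [(0,v) ∈ A] X(A′ with column v replaced by column 0)
-- where A′ is A without vertex 0: insert 0 into a listing, respectively into a cycle (or as a fixed point).

module Submission where

open import Defs
open import Data.Nat using (ℕ)
open import Data.Fin using (Fin)
open import Relation.Binary.PropositionalEquality using (_≡_)

import Algebra.Bundles as Bundles
open import Data.Bool as Bool using (Bool; true; false; if_then_else_; _∧_; _∨_; not; _xor_)
open import Data.Bool.Properties using (not-involutive; ∧-comm)
open import Data.Fin using (zero; suc; toℕ; fromℕ<; cast; punchIn; punchOut)
open import Data.Fin.Properties using (suc-injective; toℕ-injective; toℕ<n; toℕ-fromℕ<; pigeonhole; punchIn-punchOut; cast-is-id; _≟_)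
open import Data.Integer using (ℤ; 0ℤ; 1ℤ; -1ℤ; _+_; _*_; _^_) renaming (+_ to pos)
open import Data.Integer.Properties as ℤP using (+-identityˡ; +-assoc; *-distribˡ-+; *-identityˡ; *-identityʳ; *-zeroˡ; *-zeroʳ; *-assoc; *-comm)
open import Data.Integer.Solver using (module +-*-Solver)
open import Data.List using (List; []; _∷_; _++_; map; concatMap; filter; length; lookup; allFin; tabulate; applyUpTo; upTo)
open import Data.List.Membership.Propositional using (_∈_)
open import Data.List.Membership.Propositional.Properties using (∈-filter⁺; ∈-filter⁻; ∈-allFin; ∈-lookup)
open import Data.List.Properties using (length-map; map-cong; map-tabulate)
open import Data.List.Relation.Unary.All as All using ()
open import Data.List.Relation.Unary.AllPairs using (_∷_)
open import Data.List.Relation.Unary.Any using (index)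
open import Data.List.Relation.Unary.Any.Properties using (lookup-index)
open import Data.List.Relation.Unary.Unique.Propositional using (Unique)
open import Data.List.Relation.Unary.Unique.Propositional.Properties using (allFin⁺; filter⁺)
open import Data.Nat as ℕ using (zero; suc; pred; _≤_; _<_; z≤n; s≤s; _∸_; _≤ᵇ_; _<ᵇ_; _≡ᵇ_)
open import Data.Nat.DivMod using (_%_; _/_; m≡m%n+[m/n]*n; m%n<n)
open import Data.Nat.ListAction using (sum)
import Data.Nat.Properties as ℕP
open import Data.Product using (∃; _×_; _,_; proj₁; proj₂)
open import Data.Sum using (_⊎_; inj₁; inj₂)
open import Data.Unit using (tt)
open import Function using (_∘_; id)
open import Relation.Binary using (tri<; tri≈; tri>)
open import Relation.Binary.PropositionalEquality using (_≢_; _≗_; refl; sym; trans; cong; cong₂; subst; module ≡-Reasoning)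
open import Relation.Nullary using (contradiction; yes; no)
open import Algebra.Properties.Group (Bundles.AbelianGroup.group ℤP.+-0-abelianGroup) using () renaming (∙-cancelˡ to +-cancelˡ)
open ≡-Reasoning

-- Booleans

-- The recursion comes from [(0,v) ∉ A] = 1 - [(0,v) ∈ A]. Inserting 0 between consecutive entries
-- u, v of a listing replaces the factor [(u,v) ∉ A] by [(u,0) ∉ A][(0,v) ∉ A]. In the part with 1
-- the step out of u is judged by (u,0) alone, which is the effect of an empty row u; in the part
-- with (0,v) ∈ A the arc (u,0) decides about the step into v, which is the effect of column 0
-- standing in for column v. In a cycle the same two digraphs account for the insertion, because a
-- cycle through u, 0, v counts only if (u,0) and (0,v) are both arcs or both non-arcs. The identity
-- already holds for each fixed arrangement of the other vertices, summed over the places for 0, so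
-- that no cancellation between different arrangements has to be organised. Since emptying a row or
-- replacing a column can leave any special class of digraphs, the two sides are compared for all
-- digraphs at once, loops included.

∧-elim : ∀ {a b} → a ∧ b ≡ true → a ≡ true × b ≡ true
∧-elim {true} {true} _ = refl , refl

∧-intro : ∀ {a b} → a ≡ true → b ≡ true → a ∧ b ≡ true
∧-intro refl refl = refl

⇔⇒≡ : ∀ {a b} → (a ≡ true → b ≡ true) → (b ≡ true → a ≡ true) → a ≡ b
⇔⇒≡ {true}  {b}     f g = sym (f refl)
⇔⇒≡ {false} {true}  f g = g refl
⇔⇒≡ {false} {false} f g = refl

≢true : ∀ {a} → (a ≡ true → false ≡ true) → a ≡ false
≢true {true}  f = sym (f refl)
≢true {false} f = refl

==-sound : ∀ {n} (i j : Fin n) → (i == j) ≡ true → i ≡ j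
==-sound i j e = toℕ-injective (ℕP.≡ᵇ⇒≡ (toℕ i) (toℕ j) (subst Bool.T (sym e) _))

==-refl : ∀ {n} (i : Fin n) → (i == i) ≡ true
==-refl zero    = refl
==-refl (suc i) = ==-refl i

==-complete : ∀ {n} {i j : Fin n} → i ≡ j → (i == j) ≡ true
==-complete {i = i} refl = ==-refl i

all-tabulate : ∀ {X : Set} {n} (P : X → Bool) (h : Fin n → X) → all P (tabulate h) ≡ true → ∀ i → P (h i) ≡ true
all-tabulate P h e zero    = proj₁ (∧-elim e)
all-tabulate P h e (suc i) = all-tabulate P (h ∘ suc) (proj₂ (∧-elim {P (h zero)} e)) i

tabulate-all : ∀ {X : Set} {n} (P : X → Bool) (h : Fin n → X) → (∀ i → P (h i) ≡ true) → all P (tabulate h) ≡ true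
tabulate-all {n = zero}  P h e = refl
tabulate-all {n = suc n} P h e = ∧-intro (e zero) (tabulate-all P (h ∘ suc) (e ∘ suc))

allF-elim : ∀ {n} (P : Fin n → Bool) → allF P ≡ true → ∀ i → P i ≡ true
allF-elim P = all-tabulate P id

allF-intro : ∀ {n} (P : Fin n → Bool) → (∀ i → P i ≡ true) → allF P ≡ true
allF-intro P = tabulate-all P id

allF-cong : ∀ {n} (P Q : Fin n → Bool) → (∀ i → P i ≡ Q i) → allF P ≡ allF Q
allF-cong P Q e = ⇔⇒≡ (λ p → allF-intro Q λ i → trans (sym (e i)) (allF-elim P p i))
                      (λ q → allF-intro P λ i → trans (e i) (allF-elim Q q i))

allF-suc : ∀ {n} (P : Fin (suc n) → Bool) → allF P ≡ P zero ∧ allF (P ∘ suc)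
allF-suc P = ⇔⇒≡ (λ p → ∧-intro (allF-elim P p zero) (allF-intro (P ∘ suc) (allF-elim P p ∘ suc)))
                 (λ p → allF-intro P λ { zero    → proj₁ (∧-elim {P zero} p)
                                       ; (suc i) → allF-elim (P ∘ suc) (proj₂ (∧-elim {P zero} p)) i })

-- Sums over lists

⟦_⟧ : Bool → ℤ
⟦ true ⟧  = 1ℤ
⟦ false ⟧ = 0ℤ

⟦∧⟧ : ∀ a b → ⟦ a ∧ b ⟧ ≡ ⟦ a ⟧ * ⟦ b ⟧
⟦∧⟧ true  b = sym (*-identityˡ ⟦ b ⟧)
⟦∧⟧ false b = sym (*-zeroˡ ⟦ b ⟧)

⟦⟧*-cong : ∀ {a b x y} → a ≡ b → (a ≡ true → x ≡ y) → ⟦ a ⟧ * x ≡ ⟦ b ⟧ * y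
⟦⟧*-cong {true}          refl e = cong (1ℤ *_) (e refl)
⟦⟧*-cong {false} {x = x} {y} refl e = trans (*-zeroˡ x) (sym (*-zeroˡ y))

*-exchange : ∀ x y z → x * (y * z) ≡ y * (x * z)
*-exchange = solve 3 (λ x y z → x :* (y :* z) := y :* (x :* z)) refl
  where open +-*-Solver using (solve; _:=_; _:*_)

private variable
  X Y : Set

∑ : List X → (X → ℤ) → ℤ
∑ []       g = 0ℤ
∑ (x ∷ xs) g = g x + ∑ xs g

∑-cong : ∀ (xs : List X) {g h} → (∀ x → g x ≡ h x) → ∑ xs g ≡ ∑ xs h
∑-cong []       e = refl
∑-cong (x ∷ xs) e = cong₂ _+_ (e x) (∑-cong xs e)

∑-0 : ∀ (xs : List X) → ∑ xs (λ _ → 0ℤ) ≡ 0ℤ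
∑-0 []       = refl
∑-0 (x ∷ xs) = trans (+-identityˡ _) (∑-0 xs)

+-interchange : ∀ a b c d → (a + b) + (c + d) ≡ (a + c) + (b + d)
+-interchange = solve 4 (λ a b c d → (a :+ b) :+ (c :+ d) := (a :+ c) :+ (b :+ d)) refl
  where open +-*-Solver

∑-+ : ∀ (xs : List X) g h → ∑ xs (λ x → g x + h x) ≡ ∑ xs g + ∑ xs h
∑-+ []       g h = refl
∑-+ (x ∷ xs) g h = trans (cong (λ z → g x + h x + z) (∑-+ xs g h)) (+-interchange (g x) (h x) _ _)

∑-*ˡ : ∀ (xs : List X) c g → ∑ xs (λ x → c * g x) ≡ c * ∑ xs g
∑-*ˡ []       c g = sym (*-zeroʳ c)
∑-*ˡ (x ∷ xs) c g = trans (cong ((c * g x) +_) (∑-*ˡ xs c g)) (sym (*-distribˡ-+ c (g x) _))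

∑-comm : ∀ (xs : List X) (ys : List Y) (g : X → Y → ℤ) → ∑ xs (λ x → ∑ ys (g x)) ≡ ∑ ys (λ y → ∑ xs (λ x → g x y))
∑-comm []       ys g = sym (∑-0 ys)
∑-comm (x ∷ xs) ys g = trans (cong (∑ ys (g x) +_) (∑-comm xs ys g)) (sym (∑-+ ys (g x) _))

∑-++ : ∀ (xs ys : List X) g → ∑ (xs ++ ys) g ≡ ∑ xs g + ∑ ys g
∑-++ []       ys g = sym (+-identityˡ _)
∑-++ (x ∷ xs) ys g = trans (cong (g x +_) (∑-++ xs ys g)) (sym (+-assoc (g x) _ _))

∑-map : ∀ (f : X → Y) xs g → ∑ (map f xs) g ≡ ∑ xs (g ∘ f)
∑-map f []       g = refl
∑-map f (x ∷ xs) g = cong (g (f x) +_) (∑-map f xs g)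

∑-concatMap : ∀ (f : X → List Y) xs g → ∑ (concatMap f xs) g ≡ ∑ xs (λ x → ∑ (f x) g)
∑-concatMap f []       g = refl
∑-concatMap f (x ∷ xs) g = trans (∑-++ (f x) _ g) (cong (∑ (f x) g +_) (∑-concatMap f xs g))

∑-filter : ∀ (P : X → Bool) xs g → ∑ (filter (λ x → P x Bool.≟ true) xs) g ≡ ∑ xs (λ x → ⟦ P x ⟧ * g x)
∑-filter P []       g = refl
∑-filter P (x ∷ xs) g with P x
... | true  = cong₂ _+_ (sym (*-identityˡ (g x))) (∑-filter P xs g)
... | false = trans (∑-filter P xs g) (sym (trans (cong (_+ ∑ xs (λ x → ⟦ P x ⟧ * g x)) (*-zeroˡ (g x)))
    (+-identityˡ _)))

sumℤ-map : ∀ (g : X → ℤ) xs → sumℤ (map g xs) ≡ ∑ xs g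
sumℤ-map g []       = refl
sumℤ-map g (x ∷ xs) = cong (g x +_) (sumℤ-map g xs)

pos-sum-map : ∀ (g : X → ℕ) xs → pos (sum (map g xs)) ≡ ∑ xs (λ x → pos (g x))
pos-sum-map g []       = refl
pos-sum-map g (x ∷ xs) = cong (pos (g x) +_) (pos-sum-map g xs)

pos-length-filter : ∀ (P : X → Bool) xs → pos (length (filter (λ x → P x Bool.≟ true) xs)) ≡ ∑ xs (λ x → ⟦ P x ⟧)
pos-length-filter P []       = refl
pos-length-filter P (x ∷ xs) with P x
... | true  = cong (1ℤ +_) (pos-length-filter P xs)
... | false = trans (pos-length-filter P xs) (sym (+-identityˡ _))

-- Without function extensionality, allFuns lists every function exactly once only up to pointwise equality.
Enumerates : List X → (X → X → Bool) → Set
Enumerates xs _~_ = ∀ y → ∑ xs (λ x → ⟦ x ~ y ⟧) ≡ 1ℤ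

∑-select : ∀ {xs : List X} {_~_ : X → X → Bool} → Enumerates xs _~_ → ∀ y c → ∑ xs (λ x → c * ⟦ x ~ y ⟧) ≡ c
∑-select {xs = xs} {_~_} enum y c = trans (∑-*ˡ xs c (λ x → ⟦ x ~ y ⟧)) (trans (cong (c *_) (enum y)) (*-identityʳ c))

∑-bijection : ∀ {xs : List X} {_~_ : X → X → Bool} → Enumerates xs _~_ →
  ∀ {ys : List Y} {_≈_ : Y → Y → Bool} → Enumerates ys _≈_ →
  (P : X → Bool) (Q : Y → Bool) (to : X → Y) (from : Y → X) {F : X → ℤ} {G : Y → ℤ} →
  (∀ x y → P x ≡ true → (y ≈ to x) ≡ true → (Q y ≡ true × (x ~ from y) ≡ true) × F x ≡ G y) →
  (∀ x y → Q y ≡ true → (x ~ from y) ≡ true → P x ≡ true × (y ≈ to x) ≡ true) →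
  ∑ xs (λ x → ⟦ P x ⟧ * F x) ≡ ∑ ys (λ y → ⟦ Q y ⟧ * G y)
∑-bijection {xs = xs} {_~_} enum {ys} {_≈_} enum′ P Q to from {F} {G} fwd bwd = begin
  ∑ xs (λ x → ⟦ P x ⟧ * F x)
    ≡⟨ ∑-cong xs (λ x → sym (∑-select {xs = ys} {_≈_} enum′ (to x) (⟦ P x ⟧ * F x))) ⟩
  ∑ xs (λ x → ∑ ys (λ y → ⟦ P x ⟧ * F x * ⟦ y ≈ to x ⟧))
    ≡⟨ ∑-cong xs (λ x → ∑-cong ys (match x)) ⟩
  ∑ xs (λ x → ∑ ys (λ y → ⟦ Q y ⟧ * G y * ⟦ x ~ from y ⟧))
    ≡⟨ ∑-comm xs ys (λ x y → ⟦ Q y ⟧ * G y * ⟦ x ~ from y ⟧) ⟩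
  ∑ ys (λ y → ∑ xs (λ x → ⟦ Q y ⟧ * G y * ⟦ x ~ from y ⟧))
    ≡⟨ ∑-cong ys (λ y → ∑-select {xs = xs} {_~_} enum (from y) (⟦ Q y ⟧ * G y)) ⟩
  ∑ ys (λ y → ⟦ Q y ⟧ * G y) ∎
  where
  gather : ∀ a c b → ⟦ a ⟧ * c * ⟦ b ⟧ ≡ ⟦ a ∧ b ⟧ * c
  gather a c b = begin
    ⟦ a ⟧ * c * ⟦ b ⟧   ≡⟨ *-assoc ⟦ a ⟧ c ⟦ b ⟧ ⟩
    ⟦ a ⟧ * (c * ⟦ b ⟧) ≡⟨ cong (⟦ a ⟧ *_) (*-comm c ⟦ b ⟧) ⟩
    ⟦ a ⟧ * (⟦ b ⟧ * c) ≡⟨ *-assoc ⟦ a ⟧ ⟦ b ⟧ c ⟨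
    ⟦ a ⟧ * ⟦ b ⟧ * c   ≡⟨ cong (_* c) (⟦∧⟧ a b) ⟨
    ⟦ a ∧ b ⟧ * c ∎
  match : ∀ x y → ⟦ P x ⟧ * F x * ⟦ y ≈ to x ⟧ ≡ ⟦ Q y ⟧ * G y * ⟦ x ~ from y ⟧
  match x y = begin
    ⟦ P x ⟧ * F x * ⟦ y ≈ to x ⟧  ≡⟨ gather (P x) (F x) (y ≈ to x) ⟩
    ⟦ P x ∧ (y ≈ to x) ⟧ * F x
      ≡⟨ ⟦⟧*-cong
           (⇔⇒≡ (λ e → let p , t = ∧-elim e ; (q , s) , _ = fwd x y p t in ∧-intro q s)
                 (λ e → let q , s = ∧-elim {Q y} e ; p , t = bwd x y q s in ∧-intro p t))
           (λ e → let p , t = ∧-elim e in proj₂ (fwd x y p t)) ⟩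
    ⟦ Q y ∧ (x ~ from y) ⟧ * G y  ≡⟨ gather (Q y) (G y) (x ~ from y) ⟨
    ⟦ Q y ⟧ * G y * ⟦ x ~ from y ⟧ ∎

∑-tabulate : ∀ {n} (h : Fin n → X) g → ∑ (tabulate h) g ≡ ∑ (allFin n) (g ∘ h)
∑-tabulate h g = trans (cong (λ l → ∑ l g) (sym (map-tabulate id h))) (∑-map h (allFin _) g)

∑-allFin-suc : ∀ {n} (g : Fin (suc n) → ℤ) → ∑ (allFin (suc n)) g ≡ g zero + ∑ (allFin n) (g ∘ suc)
∑-allFin-suc g = cong (g zero +_) (∑-tabulate suc g)

∑-allFuns-suc : ∀ n k (G : (Fin (suc n) → Fin k) → ℤ) →
  ∑ (allFuns (suc n) k) G ≡ ∑ (allFuns n k) (λ f → ∑ (allFin k) (λ x → G (consF x f)))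
∑-allFuns-suc n k G = trans (∑-concatMap _ (allFuns n k) G) (∑-cong (allFuns n k) λ f → ∑-map _ (allFin k) G)

allFin-enumerates : ∀ n → Enumerates (allFin n) _==_
allFin-enumerates (suc n) zero    = trans (∑-allFin-suc {n} (λ i → ⟦ i == zero ⟧)) (cong (1ℤ +_) (∑-0 (allFin n)))
allFin-enumerates (suc n) (suc j) = trans (∑-allFin-suc {n} (λ i → ⟦ i == suc j ⟧))
    (trans (+-identityˡ _) (allFin-enumerates n j))

_≗ᵇ_ : ∀ {n k} → (Fin n → Fin k) → (Fin n → Fin k) → Bool
f ≗ᵇ g = allF (λ i → f i == g i)

≗ᵇ-sound : ∀ {n k} (f g : Fin n → Fin k) → f ≗ᵇ g ≡ true → f ≗ g
≗ᵇ-sound f g e i = ==-sound (f i) (g i) (allF-elim (λ i → f i == g i) e i)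

≗ᵇ-complete : ∀ {n k} (f g : Fin n → Fin k) → f ≗ g → f ≗ᵇ g ≡ true
≗ᵇ-complete f g e = allF-intro (λ i → f i == g i) λ i → ==-complete (e i)

allFuns-enumerates : ∀ n k → Enumerates (allFuns n k) _≗ᵇ_
allFuns-enumerates zero    k g = refl
allFuns-enumerates (suc n) k g = begin
  ∑ (allFuns (suc n) k) (λ f → ⟦ f ≗ᵇ g ⟧)
    ≡⟨ ∑-allFuns-suc n k _ ⟩
  ∑ (allFuns n k) (λ f → ∑ (allFin k) (λ x → ⟦ consF x f ≗ᵇ g ⟧))
    ≡⟨ ∑-cong (allFuns n k) (λ f → begin
      ∑ (allFin k) (λ x → ⟦ consF x f ≗ᵇ g ⟧)
        ≡⟨ ∑-cong (allFin k) (λ x → trans (cong ⟦_⟧ (allF-suc (λ i → consF x f i == g i)))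
            (trans (⟦∧⟧ (x == g zero) _) (*-comm ⟦ x == g zero ⟧ _))) ⟩
      ∑ (allFin k) (λ x → ⟦ f ≗ᵇ (g ∘ suc) ⟧ * ⟦ x == g zero ⟧)
        ≡⟨ ∑-select {xs = allFin k} {_==_} (allFin-enumerates k) (g zero) ⟦ f ≗ᵇ (g ∘ suc) ⟧ ⟩
      ⟦ f ≗ᵇ (g ∘ suc) ⟧ ∎) ⟩
  ∑ (allFuns n k) (λ f → ⟦ f ≗ᵇ (g ∘ suc) ⟧)
    ≡⟨ allFuns-enumerates n k (g ∘ suc) ⟩
  1ℤ ∎

-- Orbits

firstReturn : ∀ {n} → (Fin n → Fin n) → Fin n → ℕ → ℕ → ℕ
firstReturn σ i zero    k = k
firstReturn σ i (suc f) k = if iter σ k i == i then k else firstReturn σ i f (suc k)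

-- The underscore is the local function of orbitLen, which cannot be named here;
-- it is inferred from the call in orbitLen≡firstReturn.
search≡firstReturn : ∀ {n} (σ : Fin n → Fin n) (i : Fin n) (f k : ℕ) → _ ≡ firstReturn σ i f k

orbitLen≡firstReturn : ∀ {n} (σ : Fin n → Fin n) (i : Fin n) → orbitLen σ i ≡ firstReturn σ i n 1
-- Abstracting the size and the start value turns all arguments of the hidden call into distinct
-- variables, and unification can then solve for the underscore.
orbitLen≡firstReturn {suc m} σ i with suc m | 2
... | n | k = cong (if iter σ 1 i == i then 1 else_) (search≡firstReturn σ i m k)

search≡firstReturn σ i zero k = refl
search≡firstReturn σ i (suc f) k = cong (if iter σ k i == i then k else_) (search≡firstReturn σ i f (suc k))

≤ᵇ-sound : ∀ m n → (m ≤ᵇ n) ≡ true → m ≤ n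
≤ᵇ-sound m n e = ℕP.≤ᵇ⇒≤ m n (subst Bool.T (sym e) tt)

≤ᵇ-complete : ∀ {m n} → m ≤ n → (m ≤ᵇ n) ≡ true
≤ᵇ-complete {m} {n} m≤n with m ≤ᵇ n | ℕP.≤⇒≤ᵇ m≤n
... | true | _ = refl

all-applyUpTo : ∀ {X : Set} (P : X → Bool) h ℓ → all P (applyUpTo h ℓ) ≡ true → ∀ m → m < ℓ → P (h m) ≡ true
all-applyUpTo P h (suc ℓ) e zero    _         = proj₁ (∧-elim {P (h 0)} e)
all-applyUpTo P h (suc ℓ) e (suc m) (s≤s m<ℓ) = all-applyUpTo P (h ∘ suc) ℓ (proj₂ (∧-elim {P (h 0)} e)) m m<ℓ

applyUpTo-all : ∀ {X : Set} (P : X → Bool) h ℓ → (∀ m → m < ℓ → P (h m) ≡ true) → all P (applyUpTo h ℓ) ≡ true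
applyUpTo-all P h zero    e = refl
applyUpTo-all P h (suc ℓ) e = ∧-intro (e 0 (s≤s z≤n)) (applyUpTo-all P (h ∘ suc) ℓ λ m m<ℓ → e (suc m) (s≤s m<ℓ))

¬all-applyUpTo : ∀ {X : Set} (P : X → Bool) h ℓ → all P (applyUpTo h ℓ) ≡ false → ∃ λ m → P (h m) ≡ false
¬all-applyUpTo P h (suc ℓ) e with P (h 0) in eq
... | false = 0 , eq
... | true  = let m , q = ¬all-applyUpTo P (h ∘ suc) ℓ e in suc m , q

all-map : ∀ {X Y : Set} (P : Y → Bool) (g : X → Y) xs → all P (map g xs) ≡ all (P ∘ g) xs
all-map P g []       = refl
all-map P g (x ∷ xs) = cong (P (g x) ∧_) (all-map P g xs)

Inj : ∀ {n} → (Fin n → Fin n) → Set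
Inj σ = ∀ i j → σ i ≡ σ j → i ≡ j

isInjective-sound : ∀ {n} (σ : Fin n → Fin n) → isInjective σ ≡ true → Inj σ
isInjective-sound σ e i j σi≡σj = ==-sound i j (trans (sym (simplify (==-complete σi≡σj)))
    (allF-elim (λ j → if σ i == σ j then i == j else true)
      (allF-elim (λ i → allF (λ j → if σ i == σ j then i == j else true)) e i) j))
  where
  simplify : (σ i == σ j) ≡ true → (if σ i == σ j then i == j else true) ≡ (i == j)
  simplify p rewrite p = refl

isInjective-complete : ∀ {n} (σ : Fin n → Fin n) → Inj σ → isInjective σ ≡ true
isInjective-complete σ inj =
  allF-intro _ λ i → allF-intro _ λ j → implies i j
  where
  implies : ∀ i j → (if σ i == σ j then i == j else true) ≡ true
  implies i j with σ i == σ j in e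
  ... | true  = ==-complete (inj i j (==-sound (σ i) (σ j) e))
  ... | false = refl

module _ {n} (σ : Fin n → Fin n) where

  iter-+ : ∀ a b i → iter σ (a ℕ.+ b) i ≡ iter σ a (iter σ b i)
  iter-+ zero    b i = refl
  iter-+ (suc a) b i = cong σ (iter-+ a b i)

  iter-* : ∀ m p i → iter σ p i ≡ i → iter σ (m ℕ.* p) i ≡ i
  iter-* zero    p i e = refl
  iter-* (suc m) p i e = trans (iter-+ p (m ℕ.* p) i) (trans (cong (iter σ p) (iter-* m p i e)) e)

  -- The index `j` is some known return inside the searched window from `k` to `k + f`; it
  -- guarantees that the search succeeds before its fuel runs out.
  firstReturn-spec : ∀ i f k j → k ≤ j → j < k ℕ.+ f → iter σ j i ≡ i →
    let ℓ = firstReturn σ i f k in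
    k ≤ ℓ × iter σ ℓ i ≡ i × (∀ m → k ≤ m → m < ℓ → iter σ m i ≢ i)
  firstReturn-spec i zero    k j k≤j j<k r = contradiction k≤j (ℕP.<⇒≱ (subst (j <_) (ℕP.+-identityʳ k) j<k))
  firstReturn-spec i (suc f) k j k≤j j<k+f r with iter σ k i == i in e
  ... | true  = ℕP.≤-refl , ==-sound (iter σ k i) i e , λ m k≤m m<k → contradiction k≤m (ℕP.<⇒≱ m<k)
  ... | false with ℕP.m≤n⇒m<n∨m≡n k≤j
  ...   | inj₂ refl = contradiction (trans (sym e) (==-complete r)) (λ ())
  ...   | inj₁ k<j =
    let 1+k≤ℓ , ret , least = firstReturn-spec i f (suc k) j k<j (subst (j <_) (ℕP.+-suc k f) j<k+f) r in
    ℕP.≤-trans (ℕP.n≤1+n k) 1+k≤ℓ , ret , λ m k≤m m<ℓ → least′ (firstReturn σ i f (suc k)) least m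
        (ℕP.m≤n⇒m<n∨m≡n k≤m) m<ℓ
    where
    least′ : ∀ ℓ → (∀ m → suc k ≤ m → m < ℓ → iter σ m i ≢ i) → ∀ m → k < m ⊎ k ≡ m → m < ℓ → iter σ m i ≢ i
    least′ ℓ least m (inj₁ k<m) = least m k<m
    least′ ℓ least m (inj₂ refl) _ q = contradiction (trans (sym e) (==-complete q)) (λ ())

module Orbits {n} (σ : Fin n → Fin n) (σ-inj : Inj σ) where

  iter-injective : ∀ m {i j} → iter σ m i ≡ iter σ m j → i ≡ j
  iter-injective zero    e = e
  iter-injective (suc m) e = iter-injective m (σ-inj _ _ e)

  -- Two of the `n + 1` iterates with exponents 0 to `n` coincide, and injectivity cancels the
  -- smaller exponent. The bound `p ≤ n` is exactly the range that `orbitLen` searches.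
  returns : ∀ i → ∃ λ p → 1 ≤ p × p < suc n × iter σ p i ≡ i
  returns i with pigeonhole (ℕP.n<1+n n) (λ m → iter σ (toℕ m) i)
  ... | a , b , a<b , e = toℕ b ∸ toℕ a , ℕP.m<n⇒0<n∸m a<b , ℕP.≤-<-trans (ℕP.m∸n≤m (toℕ b) (toℕ a)) (toℕ<n b) ,
    iter-injective (toℕ a) (begin
      iter σ (toℕ a) (iter σ (toℕ b ∸ toℕ a) i) ≡⟨ iter-+ σ (toℕ a) _ i ⟨
      iter σ (toℕ a ℕ.+ (toℕ b ∸ toℕ a)) i      ≡⟨ cong (λ m → iter σ m i) (ℕP.m+[n∸m]≡n (ℕP.<⇒≤ a<b)) ⟩
      iter σ (toℕ b) i                          ≡⟨ e ⟨
      iter σ (toℕ a) i                          ∎)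

  orbitLen-spec : ∀ i → let ℓ = orbitLen σ i in
    1 ≤ ℓ × iter σ ℓ i ≡ i × (∀ m → 1 ≤ m → m < ℓ → iter σ m i ≢ i)
  orbitLen-spec i rewrite orbitLen≡firstReturn σ i =
    let p , 1≤p , p≤n , e = returns i in firstReturn-spec σ i n 1 p 1≤p p≤n e

  σ⁻¹ : Fin n → Fin n
  σ⁻¹ i = iter σ (pred (orbitLen σ i)) i

  σ-σ⁻¹ : ∀ i → σ (σ⁻¹ i) ≡ i
  σ-σ⁻¹ i with orbitLen σ i | orbitLen-spec i
  ... | suc p | _ , e , _ = e

  σ⁻¹-σ : ∀ i → σ⁻¹ (σ i) ≡ i
  σ⁻¹-σ i = σ-inj _ _ (σ-σ⁻¹ (σ i))

  infix 4 _⇝_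
  _⇝_ : Fin n → Fin n → Set
  i ⇝ j = ∃ λ m → iter σ m i ≡ j

  ⇝-trans : ∀ {i j k} → i ⇝ j → j ⇝ k → i ⇝ k
  ⇝-trans {i} (a , refl) (b , refl) = b ℕ.+ a , iter-+ σ b a i

  ⇝-bounded : ∀ {i j} → i ⇝ j → ∃ λ m → m < orbitLen σ i × iter σ m i ≡ j
  ⇝-bounded {i} (m , refl) with orbitLen σ i | orbitLen-spec i
  ... | suc p | _ , e , _ = m % suc p , m%n<n m (suc p) , (begin
    iter σ (m % suc p) i
      ≡⟨ cong (iter σ (m % suc p)) (iter-* σ (m / suc p) (suc p) i e) ⟨
    iter σ (m % suc p) (iter σ (m / suc p ℕ.* suc p) i)
      ≡⟨ iter-+ σ (m % suc p) _ i ⟨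
    iter σ (m % suc p ℕ.+ m / suc p ℕ.* suc p) i
      ≡⟨ cong (λ m → iter σ m i) (m≡m%n+[m/n]*n m (suc p)) ⟨
    iter σ m i ∎)

  ⇝-sym : ∀ {i j} → i ⇝ j → j ⇝ i
  ⇝-sym {i} i⇝j with ⇝-bounded i⇝j
  ... | m , m<ℓ , refl = orbitLen σ i ∸ m , (begin
    iter σ (orbitLen σ i ∸ m) (iter σ m i) ≡⟨ iter-+ σ (orbitLen σ i ∸ m) m i ⟨
    iter σ (orbitLen σ i ∸ m ℕ.+ m) i      ≡⟨ cong (λ m → iter σ m i) (ℕP.m∸n+n≡m (ℕP.<⇒≤ m<ℓ)) ⟩
    iter σ (orbitLen σ i) i                ≡⟨ proj₁ (proj₂ (orbitLen-spec i)) ⟩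
    i                                      ∎)

  ⇝-invariant : ∀ {X : Set} (h : Fin n → X) → (∀ i → h (σ i) ≡ h i) → ∀ {i j} → i ⇝ j → h j ≡ h i
  ⇝-invariant h inv (zero  , refl) = refl
  ⇝-invariant h inv {i} (suc m , refl) = trans (inv (iter σ m i)) (⇝-invariant h inv (m , refl))

  iter-distinct : ∀ i a b → a < b → b < orbitLen σ i → iter σ a i ≢ iter σ b i
  iter-distinct i a b a<b b<ℓ e = proj₂ (proj₂ (orbitLen-spec i)) (b ∸ a) (ℕP.m<n⇒0<n∸m a<b)
      (ℕP.≤-<-trans (ℕP.m∸n≤m b a) b<ℓ)
    (iter-injective a (begin
      iter σ a (iter σ (b ∸ a) i) ≡⟨ iter-+ σ a _ i ⟨
      iter σ (a ℕ.+ (b ∸ a)) i    ≡⟨ cong (λ m → iter σ m i) (ℕP.m+[n∸m]≡n (ℕP.<⇒≤ a<b)) ⟩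
      iter σ b i                  ≡⟨ e ⟨
      iter σ a i                  ∎))

  iter-injective-< : ∀ i a b → a < orbitLen σ i → b < orbitLen σ i → iter σ a i ≡ iter σ b i → a ≡ b
  iter-injective-< i a b a<ℓ b<ℓ e with ℕP.<-cmp a b
  ... | tri≈ _ a≡b _ = a≡b
  ... | tri< a<b _ _ = contradiction e (iter-distinct i a b a<b b<ℓ)
  ... | tri> _ _ b<a = contradiction (sym e) (iter-distinct i b a b<a a<ℓ)

  isRep≡all : ∀ i → isRep σ i ≡ all (λ m → toℕ i ≤ᵇ toℕ (iter σ m i)) (upTo (orbitLen σ i))
  isRep≡all i = all-map (λ j → toℕ i ≤ᵇ toℕ j) (λ m → iter σ m i) (upTo (orbitLen σ i))

  isRep-sound : ∀ {r j} → isRep σ r ≡ true → r ⇝ j → toℕ r ≤ toℕ j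
  isRep-sound {r} e r⇝j with ⇝-bounded r⇝j
  ... | m , m<ℓ , refl = ≤ᵇ-sound (toℕ r) (toℕ (iter σ m r))
      (all-applyUpTo (λ m → toℕ r ≤ᵇ toℕ (iter σ m r)) id (orbitLen σ r) (trans (sym (isRep≡all r)) e) m m<ℓ)

  isRep-complete : ∀ r → (∀ j → r ⇝ j → toℕ r ≤ toℕ j) → isRep σ r ≡ true
  isRep-complete r least = trans (isRep≡all r)
      (applyUpTo-all (λ m → toℕ r ≤ᵇ toℕ (iter σ m r)) id (orbitLen σ r) λ m _ → ≤ᵇ-complete
      (least (iter σ m r) (m , refl)))

  -- Descent: a vertex that is not the least of its orbit has a smaller iterate, and `b` bounds the
  -- number of such moves.
  rep-exists : ∀ b i → toℕ i < b → ∃ λ r → i ⇝ r × isRep σ r ≡ true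
  rep-exists (suc b) i (s≤s i≤b) with isRep σ i in e
  ... | true  = i , (0 , refl) , e
  ... | false with ¬all-applyUpTo (λ m → toℕ i ≤ᵇ toℕ (iter σ m i)) id (orbitLen σ i) (trans (sym (isRep≡all i)) e)
  ...   | m , q = let r , j⇝r , rep = rep-exists b (iter σ m i) (ℕP.<-≤-trans (ℕP.≰⇒> λ i≤j → contradiction (trans (sym q) (≤ᵇ-complete i≤j)) (λ ())) i≤b)
                  in r , ⇝-trans (m , refl) j⇝r , rep

  ρ : Fin n → Fin n
  ρ i = proj₁ (rep-exists (suc (toℕ i)) i ℕP.≤-refl)

  ⇝ρ : ∀ i → i ⇝ ρ i
  ⇝ρ i = proj₁ (proj₂ (rep-exists (suc (toℕ i)) i ℕP.≤-refl))

  isRep-ρ : ∀ i → isRep σ (ρ i) ≡ true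
  isRep-ρ i = proj₂ (proj₂ (rep-exists (suc (toℕ i)) i ℕP.≤-refl))

  rep-unique : ∀ {r s} → isRep σ r ≡ true → isRep σ s ≡ true → r ⇝ s → r ≡ s
  rep-unique p q r⇝s = toℕ-injective (ℕP.≤-antisym (isRep-sound p r⇝s) (isRep-sound q (⇝-sym r⇝s)))

  ρ-unique : ∀ {r i} → isRep σ r ≡ true → r ⇝ i → r ≡ ρ i
  ρ-unique {r} {i} p r⇝i = rep-unique p (isRep-ρ i) (⇝-trans r⇝i (⇝ρ i))

  -- The iterates of `r` below the orbit length visit each vertex of its cycle exactly once, so the
  -- inner sum is the indicator that `i` lies on the cycle of `r`.
  ρ-fibre : ∀ r i → ⟦ r == ρ i ⟧ ≡ ⟦ isRep σ r ⟧ * ∑ (allFin (orbitLen σ r)) (λ m → ⟦ i == iter σ (toℕ m) r ⟧)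
  ρ-fibre r i with isRep σ r in rep | r == ρ i in e
  ... | false | false = sym (*-zeroˡ (∑ (allFin (orbitLen σ r)) (λ m → ⟦ i == iter σ (toℕ m) r ⟧)))
  ... | false | true  = contradiction (trans (sym rep)
      (trans (cong (isRep σ) (==-sound r (ρ i) e)) (isRep-ρ i))) (λ ())
  ... | true  | false = sym (trans (*-identityˡ _) (trans (∑-cong (allFin (orbitLen σ r)) λ m → cong ⟦_⟧ (≢true λ q →
          trans (sym e) (==-complete (ρ-unique rep (toℕ m , sym (==-sound i (iter σ (toℕ m) r) q))))))
              (∑-0 (allFin (orbitLen σ r)))))
  ... | true  | true with ⇝-bounded (⇝-sym (subst (i ⇝_) (sym (==-sound r (ρ i) e)) (⇝ρ i)))
  ...   | m₀ , m₀<ℓ , refl = sym (trans (*-identityˡ _) (trans (∑-cong (allFin (orbitLen σ r)) λ m → cong ⟦_⟧ (⇔⇒≡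
          (λ q → ==-complete (toℕ-injective (trans
              (sym (iter-injective-< r m₀ (toℕ m) m₀<ℓ (toℕ<n m) (==-sound (iter σ m₀ r) (iter σ (toℕ m) r) q)))
              (sym (toℕ-fromℕ< m₀<ℓ)))))
          (λ q → ==-complete (cong (λ m → iter σ m r)
              (trans (sym (toℕ-fromℕ< m₀<ℓ)) (cong toℕ (sym (==-sound m (fromℕ< m₀<ℓ) q))))))))
          (allFin-enumerates (orbitLen σ r) (fromℕ< m₀<ℓ))))

  -- Each vertex is charged to the representative of its cycle, and a representative `r` receives
  -- `orbitLen σ r` equal charges. This turns counts of vertices into counts weighted by cycle
  -- length, for `φ` as well as for the power sums.
  ∑-orbits : ∀ (h : Fin n → ℤ) → (∀ i → h (σ i) ≡ h i) →
    ∑ (allFin n) h ≡ ∑ (allFin n) (λ r → ⟦ isRep σ r ⟧ * (pos (orbitLen σ r) * h r))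
  ∑-orbits h inv = begin
    ∑ (allFin n) h
      ≡⟨ ∑-cong (allFin n) (λ i → ∑-select {xs = allFin n} {_==_} (allFin-enumerates n) (ρ i) (h i)) ⟨
    ∑ (allFin n) (λ i → ∑ (allFin n) (λ r → h i * ⟦ r == ρ i ⟧))
      ≡⟨ ∑-comm (allFin n) (allFin n) (λ i r → h i * ⟦ r == ρ i ⟧) ⟩
    ∑ (allFin n) (λ r → ∑ (allFin n) (λ i → h i * ⟦ r == ρ i ⟧))
      ≡⟨ ∑-cong (allFin n) fibre ⟩
    ∑ (allFin n) (λ r → ⟦ isRep σ r ⟧ * (pos (orbitLen σ r) * h r)) ∎
    where
    ∑-1 : ∀ ℓ → ∑ (allFin ℓ) (λ _ → 1ℤ) ≡ pos ℓ
    ∑-1 zero    = refl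
    ∑-1 (suc ℓ) = trans (∑-allFin-suc {ℓ} (λ _ → 1ℤ)) (cong (1ℤ +_) (∑-1 ℓ))
    visits : ∀ r → ∑ (allFin n) (λ i → ∑ (allFin (orbitLen σ r)) (λ m → ⟦ i == iter σ (toℕ m) r ⟧))
        ≡ pos (orbitLen σ r)
    visits r = begin
      ∑ (allFin n) (λ i → ∑ (allFin (orbitLen σ r)) (λ m → ⟦ i == iter σ (toℕ m) r ⟧))
        ≡⟨ ∑-comm (allFin n) (allFin (orbitLen σ r)) (λ i m → ⟦ i == iter σ (toℕ m) r ⟧) ⟩
      ∑ (allFin (orbitLen σ r)) (λ m → ∑ (allFin n) (λ i → ⟦ i == iter σ (toℕ m) r ⟧))
        ≡⟨ ∑-cong (allFin (orbitLen σ r)) (λ m → allFin-enumerates n (iter σ (toℕ m) r)) ⟩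
      ∑ (allFin (orbitLen σ r)) (λ _ → 1ℤ)
        ≡⟨ ∑-1 (orbitLen σ r) ⟩
      pos (orbitLen σ r) ∎
    fibre : ∀ r → ∑ (allFin n) (λ i → h i * ⟦ r == ρ i ⟧) ≡ ⟦ isRep σ r ⟧ * (pos (orbitLen σ r) * h r)
    fibre r = begin
      ∑ (allFin n) (λ i → h i * ⟦ r == ρ i ⟧)
        ≡⟨ ∑-cong (allFin n) (λ i → trans (*-comm (h i) ⟦ r == ρ i ⟧) (trans
             (⟦⟧*-cong {r == ρ i} refl (λ e → sym (trans (cong h (==-sound r (ρ i) e)) (⇝-invariant h inv (⇝ρ i)))))
             (trans (*-comm ⟦ r == ρ i ⟧ (h r)) (cong (h r *_) (ρ-fibre r i))))) ⟩
      ∑ (allFin n) (λ i → h r * (⟦ isRep σ r ⟧ * V i))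
        ≡⟨ ∑-*ˡ (allFin n) (h r) (λ i → ⟦ isRep σ r ⟧ * V i) ⟩
      h r * ∑ (allFin n) (λ i → ⟦ isRep σ r ⟧ * V i)
        ≡⟨ cong (h r *_) (trans (∑-*ˡ (allFin n) ⟦ isRep σ r ⟧ V) (cong (⟦ isRep σ r ⟧ *_) (visits r))) ⟩
      h r * (⟦ isRep σ r ⟧ * pos (orbitLen σ r))
        ≡⟨ trans (*-comm (h r) _) (ℤP.*-assoc ⟦ isRep σ r ⟧ (pos (orbitLen σ r)) (h r)) ⟩
      ⟦ isRep σ r ⟧ * (pos (orbitLen σ r) * h r) ∎
      where
      V : Fin n → ℤ
      V i = ∑ (allFin (orbitLen σ r)) (λ m → ⟦ i == iter σ (toℕ m) r ⟧)

-- Sums over permutations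

∑-perms : ∀ n (G : (Fin n → Fin n) → ℤ) → ∑ (perms n) G ≡ ∑ (allFuns n n) (λ σ → ⟦ isInjective σ ⟧ * G σ)
∑-perms n G = ∑-filter isInjective (allFuns n n) G

∑-perms-cong : ∀ n {G H : (Fin n → Fin n) → ℤ} → (∀ σ → Inj σ → G σ ≡ H σ) → ∑ (perms n) G ≡ ∑ (perms n) H
∑-perms-cong n {G} {H} e = begin
  ∑ (perms n) G                                  ≡⟨ ∑-perms n G ⟩
  ∑ (allFuns n n) (λ σ → ⟦ isInjective σ ⟧ * G σ) ≡⟨ ∑-cong (allFuns n n)
      (λ σ → ⟦⟧*-cong {isInjective σ} refl (λ p → e σ (isInjective-sound σ p))) ⟩
  ∑ (allFuns n n) (λ σ → ⟦ isInjective σ ⟧ * H σ) ≡⟨ ∑-perms n H ⟨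
  ∑ (perms n) H ∎

∑-reindex : ∀ {n} (σ : Fin n → Fin n) → Inj σ → ∀ g → ∑ (allFin n) (g ∘ σ) ≡ ∑ (allFin n) g
∑-reindex {n} σ inj g = begin
  ∑ (allFin n) (g ∘ σ)               ≡⟨ ∑-cong (allFin n) (λ i → *-identityˡ (g (σ i))) ⟨
  ∑ (allFin n) (λ i → 1ℤ * g (σ i))  ≡⟨ ∑-bijection {xs = allFin n} {_==_}
      (allFin-enumerates n) {allFin n} {_==_} (allFin-enumerates n)
      (λ _ → true) (λ _ → true) σ σ⁻¹
      (λ i j _ e → (refl , ==-complete (trans (sym (σ⁻¹-σ i)) (cong σ⁻¹ (sym (==-sound j (σ i) e))))) , cong g
          (sym (==-sound j (σ i) e)))
      (λ i j _ e → refl , ==-complete (sym (trans (cong σ (==-sound i (σ⁻¹ j) e)) (σ-σ⁻¹ j)))) ⟩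
  ∑ (allFin n) (λ j → 1ℤ * g j)      ≡⟨ ∑-cong (allFin n) (λ j → *-identityˡ (g j)) ⟩
  ∑ (allFin n) g ∎
  where open Orbits σ inj

-- Splitting off vertex 0 of a permutation

lift : ∀ {n} → (Fin n → Fin n) → Fin (suc n) → Fin (suc n)
lift σ = consF zero (suc ∘ σ)

lift-injective : ∀ {n} (σ : Fin n → Fin n) → Inj σ → Inj (lift σ)
lift-injective σ inj zero    zero    e = refl
lift-injective σ inj (suc i) (suc j) e = cong suc (inj i j (suc-injective e))

-- The value at zero is junk.
lower : ∀ {n} → Fin (suc n) → Fin n → Fin n
lower zero    d = d
lower (suc i) d = i

suc-lower : ∀ {n} (y : Fin (suc n)) d → y ≢ zero → suc (lower y d) ≡ y
suc-lower zero    d y≢0 = contradiction refl y≢0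
suc-lower (suc y) d y≢0 = refl

-- Coset representatives for the stabiliser of 0, with `π x` sending `x` to 0. Two choices are used:
-- for listings `x` is the position of 0, for cycle structures it is the predecessor of 0 in its
-- cycle. The sum over all permutations is the same for both, but each weight has a simple local
-- identity only for its own choice.
record Transversal (n : ℕ) : Set where
  field
    π π⁻¹ : Fin (suc n) → Fin (suc n) → Fin (suc n)
    π-π⁻¹ : ∀ x j → π x (π⁻¹ x j) ≡ j
    π⁻¹-π : ∀ x j → π⁻¹ x (π x j) ≡ j
    π-0   : ∀ x → π x x ≡ zero

Extensional : ∀ {n} → ((Fin n → Fin n) → ℤ) → Set
Extensional F = ∀ σ τ → Inj σ → σ ≗ τ → F σ ≡ F τ

-- Every permutation of Fin (suc n) factors uniquely as lift σ ∘ π x, where x is the preimage of 0.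
∑-perms-suc : ∀ {n} (T : Transversal n) (let open Transversal T) (F : (Fin (suc n) → Fin (suc n)) → ℤ) → Extensional F →
  ∑ (perms (suc n)) F ≡ ∑ (perms n) (λ σ → ∑ (allFin (suc n)) (λ x → F (lift σ ∘ π x)))
∑-perms-suc {n} T F F-ext = begin
  ∑ (perms (suc n)) F
    ≡⟨ ∑-perms (suc n) F ⟩
  ∑ 𝓕 (λ σ → ⟦ isInjective σ ⟧ * F σ)
    ≡⟨ ∑-cong 𝓕 split ⟩
  ∑ 𝓕 (λ σ → ∑ 𝓧 (λ x → ⟦ isInjective σ ∧ (σ x == zero) ⟧ * F σ))
    ≡⟨ ∑-comm 𝓕 𝓧 (λ σ x → ⟦ isInjective σ ∧ (σ x == zero) ⟧ * F σ) ⟩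
  ∑ 𝓧 (λ x → ∑ 𝓕 (λ σ → ⟦ isInjective σ ∧ (σ x == zero) ⟧ * F σ))
    ≡⟨ ∑-cong 𝓧 (λ x → ∑-bijection {xs = 𝓕} {_≗ᵇ_} (allFuns-enumerates (suc n) (suc n)) {𝓖} {_≗ᵇ_}
        (allFuns-enumerates n n)
         (λ σ → isInjective σ ∧ (σ x == zero)) isInjective (to x) (from x) (fwd x) (bwd x)) ⟩
  ∑ 𝓧 (λ x → ∑ 𝓖 (λ σ → ⟦ isInjective σ ⟧ * F (from x σ)))
    ≡⟨ ∑-comm 𝓧 𝓖 (λ x σ → ⟦ isInjective σ ⟧ * F (from x σ)) ⟩
  ∑ 𝓖 (λ σ → ∑ 𝓧 (λ x → ⟦ isInjective σ ⟧ * F (from x σ)))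
    ≡⟨ ∑-cong 𝓖 (λ σ → ∑-*ˡ 𝓧 ⟦ isInjective σ ⟧ (λ x → F (from x σ))) ⟩
  ∑ 𝓖 (λ σ → ⟦ isInjective σ ⟧ * ∑ 𝓧 (λ x → F (from x σ)))
    ≡⟨ ∑-perms n (λ σ → ∑ 𝓧 (λ x → F (from x σ))) ⟨
  ∑ (perms n) (λ σ → ∑ 𝓧 (λ x → F (from x σ))) ∎
  where
  open Transversal T
  𝓕 = allFuns (suc n) (suc n)
  𝓖 = allFuns n n
  𝓧 = allFin (suc n)
  to : Fin (suc n) → (Fin (suc n) → Fin (suc n)) → Fin n → Fin n
  to x σ i = lower (σ (π⁻¹ x (suc i))) i
  from : Fin (suc n) → (Fin n → Fin n) → Fin (suc n) → Fin (suc n)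
  from x σ = lift σ ∘ π x
  π⁻¹-0 : ∀ x → π⁻¹ x zero ≡ x
  π⁻¹-0 x = trans (cong (π⁻¹ x) (sym (π-0 x))) (π⁻¹-π x x)
  π⁻¹-injective : ∀ x i j → π⁻¹ x i ≡ π⁻¹ x j → i ≡ j
  π⁻¹-injective x i j e = trans (sym (π-π⁻¹ x i)) (trans (cong (π x) e) (π-π⁻¹ x j))
  split : ∀ σ → ⟦ isInjective σ ⟧ * F σ ≡ ∑ 𝓧 (λ x → ⟦ isInjective σ ∧ (σ x == zero) ⟧ * F σ)
  split σ with isInjective σ in e
  ... | false = sym (trans (∑-cong 𝓧 λ x → *-zeroˡ (F σ)) (trans (∑-0 𝓧) (sym (*-zeroˡ (F σ)))))
  ... | true  = sym (begin
    ∑ 𝓧 (λ x → ⟦ σ x == zero ⟧ * F σ)    ≡⟨ ∑-cong 𝓧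
        (λ x → trans (*-comm _ (F σ)) (cong (λ b → F σ * ⟦ b ⟧) (at x))) ⟩
    ∑ 𝓧 (λ x → F σ * ⟦ x == σ⁻¹ zero ⟧)  ≡⟨ ∑-select {xs = 𝓧} {_==_} (allFin-enumerates (suc n)) (σ⁻¹ zero) (F σ) ⟩
    F σ                                  ≡⟨ *-identityˡ (F σ) ⟨
    1ℤ * F σ ∎)
    where
    open Orbits σ (isInjective-sound σ e)
    at : ∀ x → (σ x == zero) ≡ (x == σ⁻¹ zero)
    at x = ⇔⇒≡ (λ p → ==-complete (trans (sym (σ⁻¹-σ x)) (cong σ⁻¹ (==-sound (σ x) zero p))))
               (λ p → ==-complete (trans (cong σ (==-sound x (σ⁻¹ zero) p)) (σ-σ⁻¹ zero)))
  fwd : ∀ x σ σ′ → isInjective σ ∧ (σ x == zero) ≡ true → σ′ ≗ᵇ to x σ ≡ true →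
    (isInjective σ′ ≡ true × σ ≗ᵇ from x σ′ ≡ true) × F σ ≡ F (from x σ′)
  fwd x σ σ′ p q = (isInjective-complete σ′ σ′-inj , ≗ᵇ-complete σ (from x σ′) σ≗) , F-ext σ (from x σ′) σ-inj σ≗
    where
    σ-inj : Inj σ
    σ-inj = isInjective-sound σ (proj₁ (∧-elim p))
    σx≡0 : σ x ≡ zero
    σx≡0 = ==-sound (σ x) zero (proj₂ (∧-elim {isInjective σ} p))
    nonzero : ∀ i → σ (π⁻¹ x (suc i)) ≢ zero
    nonzero i e with π⁻¹-injective x (suc i) zero (trans (σ-inj _ _ (trans e (sym σx≡0))) (sym (π⁻¹-0 x)))
    ... | ()
    suc-σ′ : ∀ i → suc (σ′ i) ≡ σ (π⁻¹ x (suc i))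
    suc-σ′ i = trans (cong suc (≗ᵇ-sound σ′ (to x σ) q i)) (suc-lower _ i (nonzero i))
    σ′-inj : Inj σ′
    σ′-inj i j e = suc-injective (π⁻¹-injective x (suc i) (suc j)
        (σ-inj _ _ (trans (sym (suc-σ′ i)) (trans (cong suc e) (suc-σ′ j)))))
    at-π⁻¹ : ∀ y → σ (π⁻¹ x y) ≡ lift σ′ y
    at-π⁻¹ zero    = trans (cong σ (π⁻¹-0 x)) σx≡0
    at-π⁻¹ (suc i) = sym (suc-σ′ i)
    σ≗ : σ ≗ from x σ′
    σ≗ j = trans (cong σ (sym (π⁻¹-π x j))) (at-π⁻¹ (π x j))
  bwd : ∀ x σ σ′ → isInjective σ′ ≡ true → σ ≗ᵇ from x σ′ ≡ true →
    isInjective σ ∧ (σ x == zero) ≡ true × σ′ ≗ᵇ to x σ ≡ true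
  bwd x σ σ′ p q =
    ∧-intro (isInjective-complete σ σ-inj) (==-complete (trans (σ≗ x) (cong (lift σ′) (π-0 x)))) ,
    ≗ᵇ-complete σ′ (to x σ) (λ i → cong (λ y → lower y i) (sym (trans (σ≗ _) (cong (lift σ′) (π-π⁻¹ x (suc i))))))
    where
    σ≗ = ≗ᵇ-sound σ (from x σ′) q
    σ-inj : Inj σ
    σ-inj i j e = trans (sym (π⁻¹-π x i)) (trans
        (cong (π⁻¹ x) (lift-injective σ′ (isInjective-sound σ′ p) _ _ (trans (sym (σ≗ i)) (trans e (σ≗ j)))))
        (π⁻¹-π x j))

-- Deletion and contraction

tailD : ∀ {n} → Digraph (suc n) → Digraph n
tailD A i j = A (suc i) (suc j)

rowF : ∀ {n} → Digraph n → Fin n → Digraph n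
rowF A u i j = if i == u then false else A i j

colTo : ∀ {n} → Digraph n → Fin n → (Fin n → Bool) → Digraph n
colTo A v c i j = if j == v then c i else A i j

Weight : Set
Weight = ∀ {n} → Digraph n → (Fin n → Fin n) → ℤ

-- `weight-suc` is the recursion before summation over `σ`: the sum over `x` runs over all places
-- where vertex 0 can enter the fixed `σ`.
record Insertive (W : Weight) : Set where
  field
    transversal : ∀ n → Transversal n
    extensional : ∀ {n} (A : Digraph n) → Extensional (W A)
    weight-zero : ∀ (A : Digraph 0) σ → W A σ ≡ 1ℤ
    -- The negative term of the recursion is moved to the left.
    weight-suc  : ∀ {n} (A : Digraph (suc n)) σ → Inj σ →
      ∑ (allFin n) (λ v → ⟦ A zero (suc v) ⟧ * W (colTo (tailD A) v (λ i → A (suc i) zero)) σ)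
        + ∑ (allFin (suc n)) (λ x → W A (lift σ ∘ Transversal.π (transversal n) x))
      ≡ W (tailD A) σ + ∑ (allFin n) (λ u → ⟦ not (A (suc u) zero) ⟧ * W (rowF (tailD A) u) σ)

  ∑-weight-suc : ∀ {n} (A : Digraph (suc n)) →
    ∑ (allFin n) (λ v → ⟦ A zero (suc v) ⟧ * ∑ (perms n) (W (colTo (tailD A) v (λ i → A (suc i) zero))))
      + ∑ (perms (suc n)) (W A)
    ≡ ∑ (perms n) (W (tailD A)) + ∑ (allFin n) (λ u → ⟦ not (A (suc u) zero) ⟧ * ∑ (perms n) (W (rowF (tailD A) u)))
  ∑-weight-suc {n} A = begin
    ∑ (allFin n) (λ v → a v * ∑ (perms n) (col v)) + ∑ (perms (suc n)) (W A)
      ≡⟨ cong₂ _+_ (exchange a col) (∑-perms-suc (transversal n) (W A) (extensional A)) ⟩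
    ∑ (perms n) (λ σ → ∑ (allFin n) (λ v → a v * col v σ)) + ∑ (perms n) ins
      ≡⟨ ∑-+ (perms n) (λ σ → ∑ (allFin n) (λ v → a v * col v σ)) ins ⟨
    ∑ (perms n) (λ σ → ∑ (allFin n) (λ v → a v * col v σ) + ins σ)
      ≡⟨ ∑-perms-cong n (weight-suc A) ⟩
    ∑ (perms n) (λ σ → W (tailD A) σ + ∑ (allFin n) (λ u → b u * row u σ))
      ≡⟨ ∑-+ (perms n) (W (tailD A)) (λ σ → ∑ (allFin n) (λ u → b u * row u σ)) ⟩
    ∑ (perms n) (W (tailD A)) + ∑ (perms n) (λ σ → ∑ (allFin n) (λ u → b u * row u σ))
      ≡⟨ cong (∑ (perms n) (W (tailD A)) +_) (exchange b row) ⟨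
    ∑ (perms n) (W (tailD A)) + ∑ (allFin n) (λ u → b u * ∑ (perms n) (row u)) ∎
    where
    a b : Fin n → ℤ
    a v = ⟦ A zero (suc v) ⟧
    b u = ⟦ not (A (suc u) zero) ⟧
    col row : Fin n → (Fin n → Fin n) → ℤ
    col v = W (colTo (tailD A) v (λ i → A (suc i) zero))
    row u = W (rowF (tailD A) u)
    ins : (Fin n → Fin n) → ℤ
    ins σ = ∑ (allFin (suc n)) (λ x → W A (lift σ ∘ Transversal.π (transversal n) x))
    exchange : ∀ (c : Fin n → ℤ) (F : Fin n → (Fin n → Fin n) → ℤ) →
      ∑ (allFin n) (λ v → c v * ∑ (perms n) (F v)) ≡ ∑ (perms n) (λ σ → ∑ (allFin n) (λ v → c v * F v σ))
    exchange c F = trans (∑-cong (allFin n) λ v → sym (∑-*ˡ (perms n) (c v) (F v)))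
                         (∑-comm (allFin n) (perms n) (λ v σ → c v * F v σ))

-- Induction on the number of vertices. Apart from the sum over `perms (suc n)`, the recursion
-- mentions only digraphs on `n` vertices, where the two weights already have equal sums; the common
-- column terms `C` are then cancelled.
insertive-unique : ∀ {W W′ : Weight} → Insertive W → Insertive W′ → ∀ {n} (A : Digraph n) →
  ∑ (perms n) (W A) ≡ ∑ (perms n) (W′ A)
insertive-unique {W} {W′} I I′ {zero} A = cong (_+ 0ℤ)
    (trans (Insertive.weight-zero I A (λ ())) (sym (Insertive.weight-zero I′ A (λ ()))))
insertive-unique {W} {W′} I I′ {suc n} A = +-cancelˡ C _ _ (begin
  C + ∑ (perms (suc n)) (W A)
    ≡⟨ Insertive.∑-weight-suc I A ⟩
  ∑ (perms n) (W (tailD A)) + ∑ (allFin n) (λ u → ⟦ not (A (suc u) zero) ⟧ * ∑ (perms n) (W (rowF (tailD A) u)))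
    ≡⟨ cong₂ _+_ (insertive-unique I I′ (tailD A))
        (∑-cong (allFin n) λ u → cong (⟦ not (A (suc u) zero) ⟧ *_) (insertive-unique I I′ (rowF (tailD A) u))) ⟩
  ∑ (perms n) (W′ (tailD A)) + ∑ (allFin n) (λ u → ⟦ not (A (suc u) zero) ⟧ * ∑ (perms n) (W′ (rowF (tailD A) u)))
    ≡⟨ Insertive.∑-weight-suc I′ A ⟨
  ∑ (allFin n) (λ v → ⟦ A zero (suc v) ⟧ * ∑ (perms n) (W′ (colTo (tailD A) v (λ i → A (suc i) zero))))
      + ∑ (perms (suc n)) (W′ A)
    ≡⟨ cong (_+ ∑ (perms (suc n)) (W′ A)) (∑-cong (allFin n) λ v → cong (⟦ A zero (suc v) ⟧ *_)
        (insertive-unique I I′ (colTo (tailD A) v (λ i → A (suc i) zero)))) ⟨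
  C + ∑ (perms (suc n)) (W′ A) ∎)
  where
  C = ∑ (allFin n) (λ v → ⟦ A zero (suc v) ⟧ * ∑ (perms n) (W (colTo (tailD A) v (λ i → A (suc i) zero))))

≢⇒==false : ∀ {n} {i j : Fin n} → i ≢ j → (i == j) ≡ false
≢⇒==false {i = i} {j} i≢j = ≢true λ e → contradiction (==-sound i j e) i≢j

rowF-≢ : ∀ {n} (A : Digraph n) {u i} j → i ≢ u → rowF A u i j ≡ A i j
rowF-≢ A j i≢u rewrite ≢⇒==false i≢u = refl

rowF-≡ : ∀ {n} (A : Digraph n) u j → rowF A u u j ≡ false
rowF-≡ A u j rewrite ==-refl u = refl

colTo-≢ : ∀ {n} (A : Digraph n) {v} c i {j} → j ≢ v → colTo A v c i j ≡ A i j
colTo-≢ A c i j≢v rewrite ≢⇒==false j≢v = refl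

colTo-≡ : ∀ {n} (A : Digraph n) v c i → colTo A v c i v ≡ c i
colTo-≡ A v c i rewrite ==-refl v = refl

-- Listings avoiding arcs

-- The indicator that no two consecutive entries form an arc. Length and vertex set are independent
-- so that tails of a listing are covered too.
path : ∀ {n k} → Digraph k → (Fin n → Fin k) → ℤ
path {zero}        A w = 1ℤ
path {suc zero}    A w = 1ℤ
path {suc (suc n)} A w = ⟦ not (A (w zero) (w (suc zero))) ⟧ * path A (w ∘ suc)

-- The first entry of a tuple is never the endpoint of a step, hence only pairs ending in some
-- `w (suc j)` are compared. Replacing the column of the first entry therefore goes unnoticed.
path-cong : ∀ {n k l} (A : Digraph k) (B : Digraph l) (w : Fin (suc n) → Fin k) (w′ : Fin (suc n) → Fin l) →
  (∀ i j → A (w i) (w (suc j)) ≡ B (w′ i) (w′ (suc j))) → path A w ≡ path B w′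
path-cong {zero}  A B w w′ e = refl
path-cong {suc n} A B w w′ e =
  cong₂ _*_ (cong (λ b → ⟦ not b ⟧) (e zero zero)) (path-cong A B (w ∘ suc) (w′ ∘ suc) λ i j → e (suc i) (suc j))

path-ext : ∀ {n k} (A : Digraph k) {w w′ : Fin n → Fin k} → w ≗ w′ → path A w ≡ path A w′
path-ext {zero}  A e = refl
path-ext {suc n} A e = path-cong A A _ _ λ i j → cong₂ A (e i) (e (suc j))

insF : ∀ {n k} → Fin (suc n) → Fin k → (Fin n → Fin k) → Fin (suc n) → Fin k
insF         zero    v w = consF v w
insF {suc n} (suc x) v w = consF (w zero) (insF x v (w ∘ suc))

insF-at : ∀ {n k} (x : Fin (suc n)) (v : Fin k) w → insF x v w x ≡ v
insF-at         zero    v w = refl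
insF-at {suc n} (suc x) v w = insF-at x v (w ∘ suc)

insF-punchIn : ∀ {n k} (x : Fin (suc n)) (v : Fin k) w j → insF x v w (punchIn x j) ≡ w j
insF-punchIn         zero    v w j       = refl
insF-punchIn {suc n} (suc x) v w zero    = refl
insF-punchIn {suc n} (suc x) v w (suc j) = insF-punchIn x v (w ∘ suc) j

∘-insF : ∀ {n k l} (h : Fin k → Fin l) (x : Fin (suc n)) v w → h ∘ insF x v w ≗ insF x (h v) (h ∘ w)
∘-insF         h zero    v w zero    = refl
∘-insF         h zero    v w (suc j) = refl
∘-insF {suc n} h (suc x) v w zero    = refl
∘-insF {suc n} h (suc x) v w (suc j) = ∘-insF h x v (w ∘ suc) j

insertions : ∀ n → Transversal n
insertions n = record
  { π     = λ x → insF x zero suc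
  ; π⁻¹   = λ x → consF x (punchIn x)
  ; π-π⁻¹ = λ { x zero → insF-at x zero suc ; x (suc j) → insF-punchIn x zero suc j }
  ; π⁻¹-π = left
  ; π-0   = λ x → insF-at x zero suc
  }
  where
  left : ∀ x j → consF x (punchIn x) (insF x zero suc j) ≡ j
  left x j with x ≟ j
  ... | yes refl = cong (consF x (punchIn x)) (insF-at x zero suc)
  ... | no  x≢j  = begin
    consF x (punchIn x) (insF x zero suc j)
      ≡⟨ cong (λ j → consF x (punchIn x) (insF x zero suc j)) (punchIn-punchOut x≢j) ⟨
    consF x (punchIn x) (insF x zero suc (punchIn x (punchOut x≢j)))
      ≡⟨ cong (consF x (punchIn x)) (insF-punchIn x zero suc (punchOut x≢j)) ⟩
    punchIn x (punchOut x≢j)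
      ≡⟨ punchIn-punchOut x≢j ⟩
    j ∎

module _ {k} (A : Digraph (suc k)) where

  private
    A′ = tailD A
    c  : Fin k → Bool
    c i = A (suc i) zero

    rowTerm colTerm : ∀ {n} → (Fin n → Fin k) → Fin k → ℤ
    rowTerm w u = ⟦ not (c u) ⟧ * path (rowF A′ u) w
    colTerm w v = ⟦ A zero (suc v) ⟧ * path (colTo A′ v c) w

  -- For 0 placed between u and v, the column term of v and the insertion add up to the row term of
  -- u, since [(0,v) ∈ A] + [(0,v) ∉ A] = 1. For 0 placed last there is no v, and the insertion
  -- alone is the row term of the last entry. The first entry is peeled off in the induction, which
  -- is why the place in front of it is left to `path-insert`.
  path-insert-after : ∀ {n} (w : Fin (suc n) → Fin k) → (∀ i j → w i ≡ w j → i ≡ j) →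
    ∑ (allFin n) (λ p → colTerm w (w (suc p))) + ∑ (allFin (suc n)) (λ x → path A (insF (suc x) zero (suc ∘ w)))
      ≡ ∑ (allFin (suc n)) (λ p → rowTerm w (w p))
  path-insert-after {zero}  w inj = +-identityˡ _
  path-insert-after {suc n} w inj = begin
    ∑ (allFin (suc n)) (λ p → colTerm w (w (suc p)))
      + ∑ (allFin (suc (suc n))) (λ x → path A (insF (suc x) zero (suc ∘ w)))
      ≡⟨ cong₂ _+_ (∑-allFin-suc (λ p → colTerm w (w (suc p))))
          (∑-allFin-suc (λ x → path A (insF (suc x) zero (suc ∘ w)))) ⟩
    (colTerm w (w (suc zero)) + ∑ (allFin n) (λ p → colTerm w (w (suc (suc p)))))
      + (a * (⟦ not o ⟧ * path A (suc ∘ w′)) + ∑ (allFin (suc n)) (λ x → e * path A (insF (suc x) zero (suc ∘ w′))))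
      ≡⟨ cong₂ _+_ (cong₂ _+_ col₁ (trans (∑-cong (allFin n) colₚ) (∑-*ˡ (allFin n) e _)))
                   (cong₂ _+_ (cong (λ z → a * (⟦ not o ⟧ * z)) (path-cong A A′ (suc ∘ w′) w′ λ i j → refl))
                              (∑-*ˡ (allFin (suc n)) e (λ x → path A (insF (suc x) zero (suc ∘ w′))))) ⟩
    (⟦ o ⟧ * (a * P) + e * C) + (a * (⟦ not o ⟧ * P) + e * I)
      ≡⟨ algebra o ⟩
    a * P + e * (C + I)
      ≡⟨ cong (λ z → a * P + e * z) (path-insert-after w′ inj′) ⟩
    a * P + e * ∑ (allFin (suc n)) (λ p → rowTerm w′ (w′ p))
      ≡⟨ cong₂ _+_ row₀ (trans (∑-cong (allFin (suc n)) rowₚ) (∑-*ˡ (allFin (suc n)) e _)) ⟨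
    rowTerm w (w zero) + ∑ (allFin (suc n)) (λ p → rowTerm w (w (suc p)))
      ≡⟨ ∑-allFin-suc (λ p → rowTerm w (w p)) ⟨
    ∑ (allFin (suc (suc n))) (λ p → rowTerm w (w p)) ∎
    where
    w′ = w ∘ suc
    inj′ : ∀ i j → w′ i ≡ w′ j → i ≡ j
    inj′ i j = suc-injective ∘ inj (suc i) (suc j)
    o = A zero (suc (w (suc zero)))
    a = ⟦ not (c (w zero)) ⟧
    e = ⟦ not (A′ (w zero) (w (suc zero))) ⟧
    P = path A′ w′
    C = ∑ (allFin n) (λ p → colTerm w′ (w′ (suc p)))
    I = ∑ (allFin (suc n)) (λ x → path A (insF (suc x) zero (suc ∘ w′)))
    0≢ : ∀ i → w zero ≢ w (suc i)
    0≢ i q with inj zero (suc i) q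
    ... | ()
    -- Exactly one of the column term of the second entry and the insertion right after the first
    -- entry survives, and either way it equals `a * P`.
    algebra : ∀ o → (⟦ o ⟧ * (a * P) + e * C) + (a * (⟦ not o ⟧ * P) + e * I) ≡ a * P + e * (C + I)
    algebra true  = solve 5 (λ a P e C I → (con 1ℤ :* (a :* P) :+ e :* C) :+
        (a :* (con 0ℤ :* P) :+ e :* I) := a :* P :+ e :* (C :+ I)) refl a P e C I
      where open +-*-Solver
    algebra false = solve 5 (λ a P e C I → (con 0ℤ :* (a :* P) :+ e :* C) :+
        (a :* (con 1ℤ :* P) :+ e :* I) := a :* P :+ e :* (C :+ I)) refl a P e C I
      where open +-*-Solver
    col₁ : colTerm w (w (suc zero)) ≡ ⟦ o ⟧ * (a * P)
    col₁ = cong (⟦ o ⟧ *_) (cong₂ _*_ (cong (λ b → ⟦ not b ⟧) (colTo-≡ A′ (w (suc zero)) c (w zero)))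
      (path-cong _ _ w′ w′ λ i j → colTo-≢ A′ c (w′ i) λ q → contradiction (inj′ _ _ q) λ ()))
    colₚ : ∀ p → colTerm w (w (suc (suc p))) ≡ e * colTerm w′ (w′ (suc p))
    colₚ p = trans (cong (λ b → ⟦ A zero (suc (w (suc (suc p)))) ⟧ * (⟦ not b ⟧ * path (colTo A′ (w′ (suc p)) c) w′))
                         (colTo-≢ A′ c (w zero) λ q → contradiction (inj′ _ _ q) λ ()))
                   (*-exchange ⟦ A zero (suc (w (suc (suc p)))) ⟧ e _)
    row₀ : rowTerm w (w zero) ≡ a * P
    row₀ = cong (a *_) (trans (cong₂ _*_ (cong (λ b → ⟦ not b ⟧) (rowF-≡ A′ (w zero) (w (suc zero))))
                                         (path-cong _ _ w′ w′ λ i j → rowF-≢ A′ (w′ (suc j)) λ q → 0≢ i (sym q)))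
                              (*-identityˡ P))
    rowₚ : ∀ p → rowTerm w (w (suc p)) ≡ e * rowTerm w′ (w′ p)
    rowₚ p = trans (cong (λ b → ⟦ not (c (w (suc p))) ⟧ * (⟦ not b ⟧ * path (rowF A′ (w′ p)) w′))
        (rowF-≢ A′ (w (suc zero)) (0≢ p)))
                   (*-exchange ⟦ not (c (w (suc p))) ⟧ e _)

  -- The remaining place is in front of the listing. There no arc enters 0, so column term and
  -- insertion add up to the unmodified `path A′ w` in place of a row term.
  path-insert : ∀ {n} (w : Fin n → Fin k) → (∀ i j → w i ≡ w j → i ≡ j) →
    ∑ (allFin n) (λ p → colTerm w (w p)) + ∑ (allFin (suc n)) (λ x → path A (insF x zero (suc ∘ w)))
      ≡ path A′ w + ∑ (allFin n) (λ p → rowTerm w (w p))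
  path-insert {zero}  w inj = refl
  path-insert {suc n} w inj = begin
    ∑ (allFin (suc n)) (λ p → colTerm w (w p)) + ∑ (allFin (suc (suc n))) (λ x → path A (insF x zero (suc ∘ w)))
      ≡⟨ cong₂ _+_ (∑-allFin-suc (λ p → colTerm w (w p))) (∑-allFin-suc (λ x → path A (insF x zero (suc ∘ w)))) ⟩
    (colTerm w (w zero) + C) + (⟦ not o ⟧ * path A (suc ∘ w) + I)
      ≡⟨ cong₂ (λ y z → (⟦ o ⟧ * y + C) + (⟦ not o ⟧ * z + I))
           -- The replaced column belongs to the first entry, into which no step leads.
           (path-cong _ _ w w λ i j → colTo-≢ A′ c (w i) λ q → contradiction (inj _ _ q) λ ())
           (path-cong A A′ (suc ∘ w) w λ i j → refl) ⟩
    (⟦ o ⟧ * P + C) + (⟦ not o ⟧ * P + I)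
      ≡⟨ algebra o ⟩
    P + (C + I)
      ≡⟨ cong (P +_) (path-insert-after w inj) ⟩
    P + ∑ (allFin (suc n)) (λ p → rowTerm w (w p)) ∎
    where
    o = A zero (suc (w zero))
    P = path A′ w
    C = ∑ (allFin n) (λ p → colTerm w (w (suc p)))
    I = ∑ (allFin (suc n)) (λ x → path A (insF (suc x) zero (suc ∘ w)))
    algebra : ∀ o → (⟦ o ⟧ * P + C) + (⟦ not o ⟧ * P + I) ≡ P + (C + I)
    algebra true  = solve 3 (λ P C I → (con 1ℤ :* P :+ C) :+ (con 0ℤ :* P :+ I) := P :+ (C :+ I)) refl P C I
      where open +-*-Solver
    algebra false = solve 3 (λ P C I → (con 0ℤ :* P :+ C) :+ (con 1ℤ :* P :+ I) := P :+ (C :+ I)) refl P C I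
      where open +-*-Solver

path-insertive : Insertive path
path-insertive = record
  { transversal = insertions
  ; extensional = λ A σ τ _ e → path-ext A e
  ; weight-zero = λ A σ → refl
  ; weight-suc  = λ {n} A σ inj → begin
      ∑ (allFin n) (λ v → ⟦ A zero (suc v) ⟧ * path (colTo (tailD A) v (λ i → A (suc i) zero)) σ)
        + ∑ (allFin (suc n)) (λ x → path A (lift σ ∘ insF x zero suc))
        -- Sums over vertices become sums over positions of the listing, the form needed for peeling
        -- off entries.
        ≡⟨ cong₂ _+_ (∑-reindex σ inj (λ v → ⟦ A zero (suc v) ⟧ * path (colTo (tailD A) v (λ i → A (suc i) zero)) σ))
                     (∑-cong (allFin (suc n)) λ x → path-ext A (λ j → sym (∘-insF (lift σ) x zero suc j))) ⟨
      ∑ (allFin n) (λ p → ⟦ A zero (suc (σ p)) ⟧ * path (colTo (tailD A) (σ p) (λ i → A (suc i) zero)) σ)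
        + ∑ (allFin (suc n)) (λ x → path A (insF x zero (suc ∘ σ)))
        ≡⟨ path-insert A σ inj ⟩
      path (tailD A) σ + ∑ (allFin n) (λ p → ⟦ not (A (suc (σ p)) zero) ⟧ * path (rowF (tailD A) (σ p)) σ)
        ≡⟨ cong (path (tailD A) σ +_) (∑-reindex σ inj (λ u → ⟦ not (A (suc u) zero) ⟧ * path (rowF (tailD A) u) σ)) ⟩
      path (tailD A) σ + ∑ (allFin n) (λ u → ⟦ not (A (suc u) zero) ⟧ * path (rowF (tailD A) u) σ) ∎
  }

-- Signed sums over permutations with monochromatic cycles

sgn : Bool → ℤ
sgn true  = -1ℤ
sgn false = 1ℤ

sgn² : ∀ b → sgn b * sgn b ≡ 1ℤ
sgn² true  = refl
sgn² false = refl

alt : ∀ {n} → (Fin n → Bool) → ℤ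
alt {zero}  P = 1ℤ
alt {suc n} P = sgn (P zero) * alt (P ∘ suc)

alt-cong : ∀ {n} {P Q : Fin n → Bool} → P ≗ Q → alt P ≡ alt Q
alt-cong {zero}  e = refl
alt-cong {suc n} e = cong₂ _*_ (cong sgn (e zero)) (alt-cong (e ∘ suc))

alt-update : ∀ {n} (P Q : Fin n → Bool) r → P r ≡ false → (∀ i → i ≢ r → P i ≡ Q i) → sgn (Q r) * alt P ≡ alt Q
alt-update P Q zero    p e = cong (sgn (Q zero) *_) (trans (cong (λ b → sgn b * alt (P ∘ suc)) p)
  (trans (*-identityˡ (alt (P ∘ suc))) (alt-cong λ i → e (suc i) λ ())))
alt-update P Q (suc r) p e = begin
  sgn (Q (suc r)) * (sgn (P zero) * alt (P ∘ suc)) ≡⟨ *-exchange (sgn (Q (suc r))) (sgn (P zero)) (alt (P ∘ suc)) ⟩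
  sgn (P zero) * (sgn (Q (suc r)) * alt (P ∘ suc))
    ≡⟨ cong₂ _*_ (cong sgn (e zero λ ())) (alt-update (P ∘ suc) (Q ∘ suc) r p λ i i≢r → e (suc i)
        (i≢r ∘ suc-injective)) ⟩
  sgn (Q zero) * alt (Q ∘ suc) ∎

agree : Bool → Bool → Bool
agree a b = not (a xor b)

agree-sound : ∀ a b → agree a b ≡ true → a ≡ b
agree-sound true  true  _ = refl
agree-sound false false _ = refl

agree-refl : ∀ a → agree a a ≡ true
agree-refl true  = refl
agree-refl false = refl

invariantᵇ : ∀ {n} → (Fin n → Fin n) → (Fin n → Bool) → Bool
invariantᵇ σ B = allF (λ i → agree (B (σ i)) (B i))

invariantᵇ-sound : ∀ {n} (σ : Fin n → Fin n) B → invariantᵇ σ B ≡ true → ∀ i → B (σ i) ≡ B i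
invariantᵇ-sound σ B e i = agree-sound (B (σ i)) (B i) (allF-elim (λ i → agree (B (σ i)) (B i)) e i)

invariantᵇ-complete : ∀ {n} (σ : Fin n → Fin n) B → (∀ i → B (σ i) ≡ B i) → invariantᵇ σ B ≡ true
invariantᵇ-complete σ B e = allF-intro (λ i → agree (B (σ i)) (B i)) λ i → trans
    (cong (λ b → agree b (B i)) (e i)) (agree-refl (B i))

-- For the arc indicator B i = [(i , σ i) ∈ A] this is (-1)^φ(σ) if σ ∈ 𝔖(D, D̄), and 0 otherwise: σ lies in
-- 𝔖(D, D̄) iff B is constant on cycles, and then φ(σ) = #{i | B i} − #{cycles on which B holds}.
Z : ∀ {n} → (Fin n → Fin n) → (Fin n → Bool) → ℤ
Z σ B = ⟦ invariantᵇ σ B ⟧ * (alt B * alt (λ r → isRep σ r ∧ B r))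

iter-ext : ∀ {n} {σ τ : Fin n → Fin n} → σ ≗ τ → ∀ m i → iter σ m i ≡ iter τ m i
iter-ext e zero    i = refl
iter-ext {τ = τ} e (suc m) i = trans (e _) (cong τ (iter-ext e m i))

Inj-ext : ∀ {n} {σ τ : Fin n → Fin n} → σ ≗ τ → Inj σ → Inj τ
Inj-ext e inj i j p = inj i j (trans (e i) (trans p (sym (e j))))

isRep-ext : ∀ {n} (σ τ : Fin n → Fin n) → Inj σ → σ ≗ τ → ∀ r → isRep σ r ≡ isRep τ r
isRep-ext σ τ inj e r = ⇔⇒≡
  (λ p → T.isRep-complete r λ j (m , q) → S.isRep-sound p (m , trans (iter-ext e m r) q))
  (λ p → S.isRep-complete r λ j (m , q) → T.isRep-sound p (m , trans (sym (iter-ext e m r)) q))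
  where
  module S = Orbits σ inj
  module T = Orbits τ (Inj-ext e inj)

Z-ext : ∀ {n} (σ τ : Fin n → Fin n) (B C : Fin n → Bool) → Inj σ → σ ≗ τ → B ≗ C → Z σ B ≡ Z τ C
Z-ext σ τ B C inj e f = cong₂ _*_
  (cong ⟦_⟧ (allF-cong (λ i → agree (B (σ i)) (B i)) (λ i → agree (C (τ i)) (C i)) λ i → cong₂ agree
      (trans (f (σ i)) (cong C (e i))) (f i)))
  (cong₂ _*_ (alt-cong f) (alt-cong λ r → cong₂ _∧_ (isRep-ext σ τ inj e r) (f r)))

isRep-zero : ∀ {n} (σ : Fin (suc n) → Fin (suc n)) → Inj σ → isRep σ zero ≡ true
isRep-zero σ inj = Orbits.isRep-complete σ inj zero λ _ _ → z≤n

swap0 : ∀ {n} → Fin (suc n) → Fin (suc n) → Fin (suc n)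
swap0 zero    j       = j
swap0 (suc u) zero    = suc u
swap0 (suc u) (suc i) = if i == u then zero else suc i

swap0-≡ : ∀ {n} (u : Fin n) → swap0 (suc u) (suc u) ≡ zero
swap0-≡ u rewrite ==-refl u = refl

swap0-≢ : ∀ {n} {u i : Fin n} → i ≢ u → swap0 (suc u) (suc i) ≡ suc i
swap0-≢ i≢u rewrite ≢⇒==false i≢u = refl

swap0-involutive : ∀ {n} (x j : Fin (suc n)) → swap0 x (swap0 x j) ≡ j
swap0-involutive zero    j       = refl
swap0-involutive (suc u) zero    = swap0-≡ u
swap0-involutive (suc u) (suc i) with i ≟ u
... | yes refl = cong (swap0 (suc u)) (swap0-≡ u)
... | no  i≢u  = trans (cong (swap0 (suc u)) (swap0-≢ i≢u)) (swap0-≢ i≢u)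

swap0-at : ∀ {n} (x : Fin (suc n)) → swap0 x x ≡ zero
swap0-at zero    = refl
swap0-at (suc u) = swap0-≡ u

swaps : ∀ n → Transversal n
swaps n = record { π = swap0 ; π⁻¹ = swap0 ; π-π⁻¹ = swap0-involutive ; π⁻¹-π = swap0-involutive ; π-0 = swap0-at }

module _ {n} (σ : Fin n → Fin n) (σ-inj : Inj σ) where

  private
    module S = Orbits σ σ-inj

  -- A fixed point 0 is its own representative, so its sign enters once through the vertices and
  -- once through the cycles, and squares to 1. This reflects ℓ - 1 = 0, whether or not there is a
  -- loop at 0.
  Z-fixed : ∀ B → Z (lift σ) B ≡ Z σ (B ∘ suc)
  Z-fixed B = cong₂ _*_ (cong ⟦_⟧ inv) (begin
    sgn b * alt C * (sgn (isRep τ zero ∧ b) * alt (λ r → isRep τ (suc r) ∧ C r))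
      ≡⟨ cong₂ (λ p q → sgn b * alt C * (sgn (p ∧ b) * q)) (isRep-zero τ τ-inj)
          (alt-cong λ r → cong (_∧ C r) (rep r)) ⟩
    sgn b * alt C * (sgn b * K)
      ≡⟨ solve 3 (λ s a k → s :* a :* (s :* k) := s :* s :* (a :* k)) refl (sgn b) (alt C) K ⟩
    sgn b * sgn b * (alt C * K)
      ≡⟨ trans (cong (_* (alt C * K)) (sgn² b)) (*-identityˡ (alt C * K)) ⟩
    alt C * K ∎)
    where
    open +-*-Solver using (solve; _:=_; _:+_; _:*_; con)
    τ = lift σ
    τ-inj = lift-injective σ σ-inj
    module T = Orbits τ τ-inj
    b = B zero
    C = B ∘ suc
    K = alt (λ r → isRep σ r ∧ C r)
    inv : invariantᵇ τ B ≡ invariantᵇ σ C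
    inv = trans (allF-suc (λ i → agree (B (τ i)) (B i))) (cong (_∧ invariantᵇ σ C) (agree-refl b))
    iter-lift : ∀ m r → iter τ m (suc r) ≡ suc (iter σ m r)
    iter-lift zero    r = refl
    iter-lift (suc m) r = cong τ (iter-lift m r)
    rep : ∀ r → isRep τ (suc r) ≡ isRep σ r
    rep r = ⇔⇒≡ (λ p → S.isRep-complete r λ { j (m , refl) → ℕ.s≤s⁻¹ (T.isRep-sound p (m , iter-lift m r)) })
                (λ p → T.isRep-complete (suc r)
                    λ { j (m , refl) → subst (λ y → suc (toℕ r) ≤ toℕ y) (sym (iter-lift m r))
                    (s≤s (S.isRep-sound p (m , refl))) })

  -- Here 0 enters the cycle of `u` between `u` and `σ u`; `B (suc u)` and `B zero` describe the
  -- arcs into and out of 0, and constancy on the new cycle forces them to agree. The number of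
  -- cycles stays the same, with 0 replacing `ρ u` as representative, while the cycle gains one
  -- vertex: this leaves the single sign `sgn (B zero)`.
  Z-insert : ∀ u B → Z (lift σ ∘ swap0 (suc u)) B ≡ ⟦ agree (B zero) (B (suc u)) ⟧ * (sgn (B zero) * Z σ (B ∘ suc))
  Z-insert u B = begin
    ⟦ invariantᵇ τ B ⟧ * (sgn b * alt C * (sgn (isRep τ zero ∧ b) * alt Kτ))
      ≡⟨ ⟦⟧*-cong {invariantᵇ τ B} inv (λ p → signs (proj₁ (∧-elim (trans (sym inv) p)))
          (proj₂ (∧-elim {agree b (C u)} (trans (sym inv) p)))) ⟩
    ⟦ agree b (C u) ∧ invariantᵇ σ C ⟧ * (sgn b * (alt C * alt Kσ))
      ≡⟨ cong (_* (sgn b * (alt C * alt Kσ))) (⟦∧⟧ (agree b (C u)) (invariantᵇ σ C)) ⟩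
    ⟦ agree b (C u) ⟧ * ⟦ invariantᵇ σ C ⟧ * (sgn b * (alt C * alt Kσ))
      ≡⟨ solve 4 (λ x y s z → x :* y :* (s :* z) := x :* (s :* (y :* z))) refl
          ⟦ agree b (C u) ⟧ ⟦ invariantᵇ σ C ⟧ (sgn b) (alt C * alt Kσ) ⟩
    ⟦ agree b (C u) ⟧ * (sgn b * Z σ C) ∎
    where
    open +-*-Solver using (solve; _:=_; _:+_; _:*_; con)
    τ = lift σ ∘ swap0 (suc u)
    b = B zero
    C = B ∘ suc
    Kτ Kσ : Fin n → Bool
    Kτ r = isRep τ (suc r) ∧ C r
    Kσ r = isRep σ r ∧ C r
    τ-inj : Inj τ
    τ-inj i j e = trans (sym (swap0-involutive (suc u) i))
        (trans (cong (swap0 (suc u)) (lift-injective σ σ-inj (swap0 (suc u) i) (swap0 (suc u) j) e))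
        (swap0-involutive (suc u) j))
    module T = Orbits τ τ-inj
    τ-u : τ (suc u) ≡ zero
    τ-u = cong (lift σ) (swap0-≡ u)
    τ-≢ : ∀ {i} → i ≢ u → τ (suc i) ≡ suc (σ i)
    τ-≢ i≢u = cong (lift σ) (swap0-≢ i≢u)

    inv : invariantᵇ τ B ≡ agree b (C u) ∧ invariantᵇ σ C
    inv = ⇔⇒≡ fwd bwd
      where
      fwd : invariantᵇ τ B ≡ true → agree b (C u) ∧ invariantᵇ σ C ≡ true
      fwd p = ∧-intro (trans (cong (agree b) (sym b≡Cu)) (agree-refl b)) (invariantᵇ-complete σ C C-inv)
        where
        h = invariantᵇ-sound τ B p
        b≡Cu : b ≡ C u
        b≡Cu = trans (cong B (sym τ-u)) (h (suc u))
        C-inv : ∀ i → C (σ i) ≡ C i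
        C-inv i with i ≟ u
        ... | yes refl = trans (h zero) b≡Cu
        ... | no  i≢u  = trans (cong B (sym (τ-≢ i≢u))) (h (suc i))
      bwd : agree b (C u) ∧ invariantᵇ σ C ≡ true → invariantᵇ τ B ≡ true
      bwd p = invariantᵇ-complete τ B h
        where
        b≡Cu = agree-sound b (C u) (proj₁ (∧-elim p))
        C-inv = invariantᵇ-sound σ C (proj₂ (∧-elim {agree b (C u)} p))
        h : ∀ i → B (τ i) ≡ B i
        h zero = trans (C-inv u) (sym b≡Cu)
        h (suc i) with i ≟ u
        ... | yes refl = trans (cong B τ-u) b≡Cu
        ... | no  i≢u  = trans (cong B (τ-≢ i≢u)) (C-inv i)

    step : ∀ i → suc i T.⇝ suc (σ i)
    step i with i ≟ u
    ... | yes refl = 2 , cong τ τ-u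
    ... | no  i≢u  = 1 , τ-≢ i≢u
    embed : ∀ {i j} → i S.⇝ j → suc i T.⇝ suc j
    embed (zero  , refl) = 0 , refl
    embed {i} (suc m , refl) = T.⇝-trans (embed (m , refl)) (step (iter σ m i))
    -- The orbit of `suc r` under `τ` shadows the orbit of `r` under `σ`; while `τ` rests at 0, the
    -- shadow waits at `u`.
    project : ∀ r m → (∃ λ j → iter τ m (suc r) ≡ suc j × r S.⇝ j) ⊎ (iter τ m (suc r) ≡ zero × r S.⇝ u)
    project r zero    = inj₁ (r , refl , 0 , refl)
    project r (suc m) with project r m
    ... | inj₂ (e , r⇝u) = inj₁ (σ u , cong τ e , S.⇝-trans r⇝u (1 , refl))
    ... | inj₁ (j , e , r⇝j) with j ≟ u
    ...   | yes refl = inj₂ (trans (cong τ e) τ-u , r⇝j)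
    ...   | no  j≢u  = inj₁ (σ j , trans (cong τ e) (τ-≢ j≢u) , S.⇝-trans r⇝j (1 , refl))

    rep-ρ : isRep τ (suc (S.ρ u)) ≡ false
    rep-ρ = ≢true λ p → contradiction (T.isRep-sound p (T.⇝-trans (embed (S.⇝-sym (S.⇝ρ u))) (1 , τ-u))) λ ()
    rep-≢ : ∀ r → r ≢ S.ρ u → isRep τ (suc r) ≡ isRep σ r
    rep-≢ r r≢ρ = ⇔⇒≡
      (λ p → S.isRep-complete r λ j r⇝j → ℕ.s≤s⁻¹ (T.isRep-sound p (embed r⇝j)))
      (λ p → T.isRep-complete (suc r) λ { j (m , refl) → bound p m (project r m) })
      where
      bound : isRep σ r ≡ true → ∀ m → (∃ λ j → iter τ m (suc r) ≡ suc j × r S.⇝ j) ⊎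
          (iter τ m (suc r) ≡ zero × r S.⇝ u) → suc (toℕ r) ≤ toℕ (iter τ m (suc r))
      bound p m (inj₁ (j , e , r⇝j)) = subst (λ y → suc (toℕ r) ≤ toℕ y) (sym e) (s≤s (S.isRep-sound p r⇝j))
      bound p m (inj₂ (_ , r⇝u))     = contradiction (S.ρ-unique p r⇝u) r≢ρ

    signs : agree b (C u) ≡ true → invariantᵇ σ C ≡ true →
      sgn b * alt C * (sgn (isRep τ zero ∧ b) * alt Kτ) ≡ sgn b * (alt C * alt Kσ)
    signs p q = begin
      sgn b * alt C * (sgn (isRep τ zero ∧ b) * alt Kτ)
        ≡⟨ cong (λ x → sgn b * alt C * (sgn (x ∧ b) * alt Kτ)) (isRep-zero τ τ-inj) ⟩
      sgn b * alt C * (sgn b * alt Kτ)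
        ≡⟨ cong (λ x → sgn b * alt C * (sgn x * alt Kτ)) (sym Kρ) ⟩
      sgn b * alt C * (sgn (Kσ (S.ρ u)) * alt Kτ)
        ≡⟨ cong (sgn b * alt C *_) (alt-update Kτ Kσ (S.ρ u) (cong (_∧ C (S.ρ u)) rep-ρ)
            (λ r r≢ρ → cong (_∧ C r) (rep-≢ r r≢ρ))) ⟩
      sgn b * alt C * alt Kσ
        ≡⟨ *-assoc (sgn b) (alt C) (alt Kσ) ⟩
      sgn b * (alt C * alt Kσ) ∎
      where
      Kρ : Kσ (S.ρ u) ≡ b
      Kρ = trans (cong (_∧ C (S.ρ u)) (S.isRep-ρ u))
          (trans (S.⇝-invariant C (invariantᵇ-sound σ C q) (S.⇝ρ u)) (sym (agree-sound b (C u) p)))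

cycleWeight : Weight
cycleWeight A σ = Z σ (λ i → A i (σ i))

cycleWeight-insertive : Insertive cycleWeight
cycleWeight-insertive = record
  { transversal = swaps
  ; extensional = λ A σ τ inj e → Z-ext σ τ (λ i → A i (σ i)) (λ i → A i (τ i)) inj e λ i → cong (A i) (e i)
  ; weight-zero = λ A σ → refl
  ; weight-suc  = weight-suc
  }
  where
  weight-suc : ∀ {n} (A : Digraph (suc n)) σ → Inj σ →
      ∑ (allFin n) (λ v → ⟦ A zero (suc v) ⟧ * cycleWeight (colTo (tailD A) v (λ i → A (suc i) zero)) σ)
        + ∑ (allFin (suc n)) (λ x → cycleWeight A (lift σ ∘ swap0 x))
      ≡ cycleWeight (tailD A) σ + ∑ (allFin n) (λ u → ⟦ not (A (suc u) zero) ⟧ * cycleWeight (rowF (tailD A) u) σ)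
  weight-suc {n} A σ inj = begin
    ∑ (allFin n) col + ∑ (allFin (suc n)) ins
      -- Reindexing by `σ` pairs the column of `σ u` with the insertion of 0 between `u` and `σ u`,
      -- and both with the row of `u`.
      ≡⟨ cong₂ _+_ (sym (∑-reindex σ inj col)) (∑-allFin-suc ins) ⟩
    ∑ (allFin n) (col ∘ σ) + (ins zero + ∑ (allFin n) (ins ∘ suc))
      ≡⟨ solve 3 (λ a b c → a :+ (b :+ c) := b :+ (a :+ c)) refl (∑ (allFin n) (col ∘ σ)) (ins zero)
          (∑ (allFin n) (ins ∘ suc)) ⟩
    ins zero + (∑ (allFin n) (col ∘ σ) + ∑ (allFin n) (ins ∘ suc))
      ≡⟨ cong₂ _+_ (Z-fixed σ inj (λ i → A i (lift σ i)))
          (trans (sym (∑-+ (allFin n) (col ∘ σ) (ins ∘ suc))) (∑-cong (allFin n) local)) ⟩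
    cycleWeight (tailD A) σ + ∑ (allFin n) row ∎
    where
    open +-*-Solver using (solve; _:=_; _:+_; _:*_; con)
    col row : Fin n → ℤ
    col v = ⟦ A zero (suc v) ⟧ * cycleWeight (colTo (tailD A) v (λ i → A (suc i) zero)) σ
    row u = ⟦ not (A (suc u) zero) ⟧ * cycleWeight (rowF (tailD A) u) σ
    ins : Fin (suc n) → ℤ
    ins x = cycleWeight A (lift σ ∘ swap0 x)
    local : ∀ u → col (σ u) + ins (suc u) ≡ row u
    local u = begin
      col (σ u) + ins (suc u)
        ≡⟨ cong₂ _+_ (cong (⟦ b ⟧ *_) (Z-ext σ σ _ C inj (λ _ → refl) col≗)) (Z-insert σ inj u B) ⟩
      ⟦ b ⟧ * Z σ C + ⟦ agree b (C u) ⟧ * (sgn b * Z σ C)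
        ≡⟨ colours b (C u) refl ⟩
      ⟦ not (C u) ⟧ * Z σ (λ i → rowF (tailD A) u i (σ i))
        ≡⟨ cong (λ x → ⟦ not x ⟧ * Z σ (λ i → rowF (tailD A) u i (σ i))) C-u ⟩
      row u ∎
      where
      τ = lift σ ∘ swap0 (suc u)
      B : Fin (suc n) → Bool
      B i = A i (τ i)
      b = B zero
      C = B ∘ suc
      C-u : C u ≡ A (suc u) zero
      C-u = cong (A (suc u) ∘ lift σ) (swap0-≡ u)
      C-≢ : ∀ {i} → i ≢ u → C i ≡ tailD A i (σ i)
      C-≢ {i} i≢u = cong (A (suc i) ∘ lift σ) (swap0-≢ i≢u)
      col≗ : ∀ i → colTo (tailD A) (σ u) (λ i → A (suc i) zero) i (σ i) ≡ C i
      col≗ i with i ≟ u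
      ... | yes refl = trans (colTo-≡ (tailD A) (σ u) (λ i → A (suc i) zero) u) (sym C-u)
      ... | no  i≢u  = trans (colTo-≢ (tailD A) (λ i → A (suc i) zero) i (λ e → i≢u (inj i u e))) (sym (C-≢ i≢u))
      row≗ : C u ≡ false → ∀ i → C i ≡ rowF (tailD A) u i (σ i)
      row≗ p i with i ≟ u
      ... | yes refl = trans p (sym (rowF-≡ (tailD A) u (σ u)))
      ... | no  i≢u  = trans (C-≢ i≢u) (sym (rowF-≢ (tailD A) (σ i) i≢u))
      -- If (u,0) is an arc, the left side vanishes: for (0,σ u) an arc the lengthened cycle has the
      -- opposite sign and cancels the column term, otherwise both terms are zero. If (u,0) is a
      -- non-arc, exactly one of the two terms survives, and `C` is then the arc indicator of the
      -- digraph with row `u` emptied.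
      colours : ∀ b c → C u ≡ c → ⟦ b ⟧ * Z σ C + ⟦ agree b c ⟧ * (sgn b * Z σ C)
          ≡ ⟦ not c ⟧ * Z σ (λ i → rowF (tailD A) u i (σ i))
      colours true  true  p = solve 2 (λ z y → con 1ℤ :* z :+ con 1ℤ :* (con -1ℤ :* z) := con 0ℤ :* y) refl
          (Z σ C) (Z σ (λ i → rowF (tailD A) u i (σ i)))
      colours false true  p = solve 2 (λ z y → con 0ℤ :* z :+ con 0ℤ :* (con 1ℤ :* z) := con 0ℤ :* y) refl
          (Z σ C) (Z σ (λ i → rowF (tailD A) u i (σ i)))
      colours true  false p = trans (solve 1 (λ z → con 1ℤ :* z :+ con 0ℤ :* (con -1ℤ :* z) := con 1ℤ :* z) refl
          (Z σ C)) (cong (1ℤ *_) (Z-ext σ σ C _ inj (λ _ → refl) (row≗ p)))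
      colours false false p = trans (solve 1 (λ z → con 0ℤ :* z :+ con 1ℤ :* (con 1ℤ :* z) := con 1ℤ :* z) refl
          (Z σ C)) (cong (1ℤ *_) (Z-ext σ σ C _ inj (λ _ → refl) (row≗ p)))

-- Colourings and the twisted digraph

content : ∀ {n k} → (Fin k → ℕ) → (Fin n → Fin k) → Bool
content α f = allF (λ v → countF (λ i → f i == v) ≡ᵇ α v)

pos-countF : ∀ {n} (P : Fin n → Bool) → pos (countF P) ≡ ∑ (allFin n) (λ i → ⟦ P i ⟧)
pos-countF {n} P = pos-length-filter P (allFin n)

content-cong : ∀ {n k} (α : Fin k → ℕ) (f g : Fin n → Fin k) →
  (∀ v → ∑ (allFin n) (λ i → ⟦ f i == v ⟧) ≡ ∑ (allFin n) (λ i → ⟦ g i == v ⟧)) → content α f ≡ content α g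
content-cong α f g e = allF-cong _ _ λ v → cong (_≡ᵇ α v)
  (ℤP.+-injective (trans (pos-countF (λ i → f i == v)) (trans (e v) (sym (pos-countF (λ i → g i == v))))))

-- The body negates the condition that `coeffL` imposes on two consecutive entries, so that
-- compatibility of a sequence becomes avoidance of arcs.
twist : ∀ {n k} → Digraph n → (Fin n → Fin k) → Digraph n
twist A f a b = not ((toℕ (f a) ≤ᵇ toℕ (f b)) ∧ (if A a b then toℕ (f a) <ᵇ toℕ (f b) else true))

<ᵇ-irrefl : ∀ m → (m <ᵇ m) ≡ false
<ᵇ-irrefl zero    = refl
<ᵇ-irrefl (suc m) = <ᵇ-irrefl m

twist-level : ∀ {n k} (A : Digraph n) (f : Fin n → Fin k) a b → f b ≡ f a → twist A f a b ≡ A a b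
twist-level A f a b e rewrite e | ≤ᵇ-complete {toℕ (f a)} ℕP.≤-refl with A a b
... | true  rewrite <ᵇ-irrefl (toℕ (f a)) = refl
... | false = refl

-- Together with `twist-false`: colours weakly fall along arcs of the twist and weakly rise along
-- non-arcs. Around a cycle of one kind they must come back to their start, hence be constant.
twist-true : ∀ {n k} (A : Digraph n) (f : Fin n → Fin k) a b → twist A f a b ≡ true → toℕ (f b) ≤ toℕ (f a)
twist-true A f a b p with toℕ (f a) ≤ᵇ toℕ (f b) in e₁ | toℕ (f a) <ᵇ toℕ (f b) in e₂ | A a b
... | false | _     | _    = ℕP.<⇒≤ (ℕP.≰⇒> λ q → contradiction (trans (sym e₁) (≤ᵇ-complete q)) λ ())
... | true  | false | true = ℕP.≮⇒≥ λ q → subst Bool.T e₂ (ℕP.<⇒<ᵇ q)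

twist-false : ∀ {n k} (A : Digraph n) (f : Fin n → Fin k) a b → twist A f a b ≡ false → toℕ (f a) ≤ toℕ (f b)
twist-false A f a b p with toℕ (f a) ≤ᵇ toℕ (f b) in e₁
... | true = ≤ᵇ-sound (toℕ (f a)) (toℕ (f b)) e₁

-- The left-hand side

path≡allF : ∀ {n k} (D : Digraph k) (w : Fin n → Fin k) → path D w
    ≡ ⟦ allF (λ (p : Fin (pred n)) → not (D (w (lo p)) (w (hi p)))) ⟧
path≡allF {zero}        D w = refl
path≡allF {suc zero}    D w = refl
path≡allF {suc (suc n)} D w = begin
  ⟦ not (D (w zero) (w (suc zero))) ⟧ * path D (w ∘ suc)
    ≡⟨ cong (⟦ not (D (w zero) (w (suc zero))) ⟧ *_) (path≡allF D (w ∘ suc)) ⟩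
  ⟦ not (D (w zero) (w (suc zero))) ⟧ * ⟦ allF (λ (p : Fin n) → not (D (w (suc (lo p))) (w (suc (suc p))))) ⟧
    ≡⟨ ⟦∧⟧ (not (D (w zero) (w (suc zero)))) _ ⟨
  ⟦ not (D (w zero) (w (suc zero))) ∧ allF (λ (p : Fin n) → not (D (w (suc (lo p))) (w (suc (suc p))))) ⟧
    ≡⟨ cong ⟦_⟧ (allF-suc (λ (p : Fin (suc n)) → not (D (w (lo p)) (w (hi p))))) ⟨
  ⟦ allF (λ (p : Fin (suc n)) → not (D (w (lo p)) (w (hi p)))) ⟧ ∎

module _ {n} (A : Digraph n) (k : ℕ) (α : Fin k → ℕ) where

  private
    𝓕 = allFuns n k

  -- A sequence indexed by positions is read as a colouring of vertices through `s = f ∘ w`.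
  -- Reordering by `w` preserves the content, and the index set of the sum no longer depends on `w`,
  -- which allows the exchange of sums in `coeffU≡∑`.
  coeffL-perm : ∀ w → Inj w → pos (coeffL n (Des w A) k α) ≡ ∑ 𝓕 (λ f → ⟦ content α f ⟧ * path (twist A f) w)
  coeffL-perm w inj = begin
    pos (coeffL n (Des w A) k α)
      ≡⟨ pos-length-filter (λ s → steps s ∧ content α s) 𝓕 ⟩
    ∑ 𝓕 (λ s → ⟦ steps s ∧ content α s ⟧)
      ≡⟨ ∑-cong 𝓕 (λ s → *-identityʳ ⟦ steps s ∧ content α s ⟧) ⟨
    ∑ 𝓕 (λ s → ⟦ steps s ∧ content α s ⟧ * 1ℤ)
      ≡⟨ ∑-bijection {xs = 𝓕} {_≗ᵇ_} (allFuns-enumerates n k) {𝓕} {_≗ᵇ_} (allFuns-enumerates n k)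
           -- In this scope `σ⁻¹` is the inverse of the listing `w`.
           (λ s → steps s ∧ content α s) good (_∘ σ⁻¹) (_∘ w)
           (λ s f p q → let s≗ = λ i → trans (cong s (sym (σ⁻¹-σ i))) (sym (≗ᵇ-sound f (s ∘ σ⁻¹) q (w i))) in
              (trans (sym (transport s f s≗)) p , ≗ᵇ-complete s (f ∘ w) s≗) , refl)
           (λ s f p q → let s≗ = ≗ᵇ-sound s (f ∘ w) q in
              trans (transport s f s≗) p , ≗ᵇ-complete f (s ∘ σ⁻¹)
                  (λ j → sym (trans (s≗ (σ⁻¹ j)) (cong f (σ-σ⁻¹ j))))) ⟩
    ∑ 𝓕 (λ f → ⟦ good f ⟧ * 1ℤ)
      ≡⟨ ∑-cong 𝓕 (λ f → trans (*-identityʳ ⟦ good f ⟧)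
          (trans (⟦∧⟧ (content α f) _) (cong (⟦ content α f ⟧ *_) (sym (path≡allF (twist A f) w))))) ⟩
    ∑ 𝓕 (λ f → ⟦ content α f ⟧ * path (twist A f) w) ∎
    where
    open Orbits w inj
    steps : (Fin n → Fin k) → Bool
    steps s = allF (λ (p : Fin (pred n)) → (toℕ (s (lo p)) ≤ᵇ toℕ (s (hi p))) ∧
        (if Des w A p then toℕ (s (lo p)) <ᵇ toℕ (s (hi p)) else true))
    good : (Fin n → Fin k) → Bool
    good f = content α f ∧ allF (λ (p : Fin (pred n)) → not (twist A f (w (lo p)) (w (hi p))))
    transport : ∀ s f → s ≗ f ∘ w → steps s ∧ content α s ≡ good f
    transport s f e = trans (cong₂ _∧_
        (allF-cong _ _ λ p → trans (cong₂ (λ x y → (toℕ x ≤ᵇ toℕ y) ∧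
            (if Des w A p then toℕ x <ᵇ toℕ y else true)) (e (lo p)) (e (hi p)))
                                   (sym (not-involutive _)))
        (content-cong α s f λ v → trans (∑-cong (allFin n) λ i → cong (λ x → ⟦ x == v ⟧) (e i))
            (∑-reindex w inj (λ i → ⟦ f i == v ⟧))))
      (∧-comm (allF (λ (p : Fin (pred n)) → not (twist A f (w (lo p)) (w (hi p))))) (content α f))

  coeffU≡∑ : coeffU A k α ≡ ∑ 𝓕 (λ f → ⟦ content α f ⟧ * ∑ (perms n) (path (twist A f)))
  coeffU≡∑ = begin
    coeffU A k α
      ≡⟨ pos-sum-map (λ w → coeffL n (Des w A) k α) (perms n) ⟩
    ∑ (perms n) (λ w → pos (coeffL n (Des w A) k α))
      ≡⟨ ∑-perms-cong n coeffL-perm ⟩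
    ∑ (perms n) (λ w → ∑ 𝓕 (λ f → ⟦ content α f ⟧ * path (twist A f) w))
      ≡⟨ ∑-comm (perms n) 𝓕 (λ w f → ⟦ content α f ⟧ * path (twist A f) w) ⟩
    ∑ 𝓕 (λ f → ∑ (perms n) (λ w → ⟦ content α f ⟧ * path (twist A f) w))
      ≡⟨ ∑-cong 𝓕 (λ f → ∑-*ˡ (perms n) ⟦ content α f ⟧ (path (twist A f))) ⟩
    ∑ 𝓕 (λ f → ⟦ content α f ⟧ * ∑ (perms n) (path (twist A f))) ∎

-- The right-hand side

constantᵇ : ∀ {n k} → (Fin n → Fin n) → (Fin n → Fin k) → Bool
constantᵇ σ f = allF (λ i → f (σ i) == f i)

constantᵇ-sound : ∀ {n k} (σ : Fin n → Fin n) (f : Fin n → Fin k) → constantᵇ σ f ≡ true → ∀ i → f (σ i) ≡ f i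
constantᵇ-sound σ f p i = ==-sound (f (σ i)) (f i) (allF-elim (λ i → f (σ i) == f i) p i)

cnt : ∀ {n} → (Fin n → Bool) → ℕ
cnt {zero}  P = 0
cnt {suc n} P = (if P zero then suc else id) (cnt (P ∘ suc))

pos-cnt : ∀ {n} (P : Fin n → Bool) → pos (cnt P) ≡ ∑ (allFin n) (λ i → ⟦ P i ⟧)
pos-cnt {zero}  P = refl
pos-cnt {suc n} P = trans (head (P zero)) (sym (∑-allFin-suc (λ i → ⟦ P i ⟧)))
  where
  head : ∀ b → pos ((if b then suc else id) (cnt (P ∘ suc))) ≡ ⟦ b ⟧ + ∑ (allFin n) (λ i → ⟦ P (suc i) ⟧)
  head true  = cong (1ℤ +_) (pos-cnt (P ∘ suc))
  head false = trans (pos-cnt (P ∘ suc)) (sym (+-identityˡ _))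

alt≡-1^ : ∀ {n} (P : Fin n → Bool) → alt P ≡ -1ℤ ^ cnt P
alt≡-1^ {zero}  P = refl
alt≡-1^ {suc n} P with P zero
... | true  = cong (-1ℤ *_) (alt≡-1^ (P ∘ suc))
... | false = trans (*-identityˡ (alt (P ∘ suc))) (alt≡-1^ (P ∘ suc))

alt² : ∀ {n} (P : Fin n → Bool) → alt P * alt P ≡ 1ℤ
alt² {zero}  P = refl
alt² {suc n} P = begin
  sgn (P zero) * alt (P ∘ suc) * (sgn (P zero) * alt (P ∘ suc))
    ≡⟨ solve 2 (λ s a → s :* a :* (s :* a) := s :* s :* (a :* a)) refl (sgn (P zero)) (alt (P ∘ suc)) ⟩
  sgn (P zero) * sgn (P zero) * (alt (P ∘ suc) * alt (P ∘ suc))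
    ≡⟨ cong₂ _*_ (sgn² (P zero)) (alt² (P ∘ suc)) ⟩
  1ℤ ∎
  where open +-*-Solver using (solve; _:=_; _:*_)

all-filter : ∀ {X : Set} (P Q : X → Bool) xs → all P (filter (λ x → Q x Bool.≟ true) xs)
    ≡ all (λ x → not (Q x) ∨ P x) xs
all-filter P Q []       = refl
all-filter P Q (x ∷ xs) with Q x
... | true  = cong (P x ∧_) (all-filter P Q xs)
... | false = all-filter P Q xs

lookup-injective : ∀ {X : Set} {xs : List X} → Unique xs → ∀ i j → lookup xs i ≡ lookup xs j → i ≡ j
lookup-injective (x∉ ∷ u) zero    zero    e = refl
lookup-injective (x∉ ∷ u) (suc i) (suc j) e = cong suc (lookup-injective u i j e)
lookup-injective {xs = _ ∷ xs} (x∉ ∷ u) zero    (suc j) e = contradiction e (All.lookup x∉ (∈-lookup {xs = xs} j))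
lookup-injective {xs = _ ∷ xs} (x∉ ∷ u) (suc i) zero    e = contradiction (sym e)
    (All.lookup x∉ (∈-lookup {xs = xs} i))

∑-lookup : ∀ {X : Set} (xs : List X) g → ∑ (allFin (length xs)) (g ∘ lookup xs) ≡ ∑ xs g
∑-lookup []       g = refl
∑-lookup (x ∷ xs) g = trans (∑-allFin-suc (g ∘ lookup (x ∷ xs))) (cong (g x +_) (∑-lookup xs g))

lookup-map : ∀ {X Y : Set} (g : X → Y) xs i → lookup (map g xs) i ≡ g (lookup xs (cast (length-map g xs) i))
lookup-map g (x ∷ xs) zero    = refl
lookup-map g (x ∷ xs) (suc i) = lookup-map g xs i

module _ {n} (σ : Fin n → Fin n) (σ-inj : Inj σ) where

  open Orbits σ σ-inj

  isDCycle-sound : ∀ A {r j} → isDCycle A σ r ≡ true → r ⇝ j → A j (σ j) ≡ true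
  isDCycle-sound A {r} e r⇝j with ⇝-bounded r⇝j
  ... | m , m<ℓ , refl = all-applyUpTo (λ m → A (iter σ m r) (iter σ (suc m) r)) id (orbitLen σ r) e m m<ℓ

  isDCycle-complete : ∀ A r → (∀ j → r ⇝ j → A j (σ j) ≡ true) → isDCycle A σ r ≡ true
  isDCycle-complete A r e = applyUpTo-all (λ m → A (iter σ m r) (iter σ (suc m) r)) id (orbitLen σ r) λ m _ → e
      (iter σ m r) (m , refl)

  module _ (A : Digraph n) where

    private
      B : Fin n → Bool
      B i = A i (σ i)

    -- A cycle has only arcs or only non-arcs exactly when `B` is constant along it. The definition
    -- tests representatives only; every vertex is reached through `ρ`.
    inSDD≡invariant : inSDD A σ ≡ invariantᵇ σ B
    inSDD≡invariant = trans (all-filter mono (isRep σ) (allFin n)) (⇔⇒≡ fwd bwd)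
      where
      mono : Fin n → Bool
      mono i = isDCycle A σ i ∨ isDCycle (complement A) σ i
      not-true : ∀ {b} → not b ≡ true → b ≡ false
      not-true {false} _ = refl
      constant : ∀ i → mono (ρ i) ≡ true → B (σ i) ≡ B i
      constant i p with isDCycle A σ (ρ i) in e
      ... | true  = trans (on (⇝-trans ρ⇝i (1 , refl))) (sym (on ρ⇝i))
        where
        ρ⇝i = ⇝-sym (⇝ρ i)
        on : ∀ {j} → ρ i ⇝ j → B j ≡ true
        on = isDCycle-sound A e
      ... | false = trans (off (⇝-trans ρ⇝i (1 , refl))) (sym (off ρ⇝i))
        where
        ρ⇝i = ⇝-sym (⇝ρ i)
        off : ∀ {j} → ρ i ⇝ j → B j ≡ false
        off r⇝j = not-true (isDCycle-sound (complement A) p r⇝j)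
      fwd : allF (λ i → not (isRep σ i) ∨ mono i) ≡ true → invariantᵇ σ B ≡ true
      fwd p = invariantᵇ-complete σ B λ i → constant i
        (trans (cong (λ b → not b ∨ mono (ρ i)) (sym (isRep-ρ i)))
            (allF-elim (λ i → not (isRep σ i) ∨ mono i) p (ρ i)))
      bwd : invariantᵇ σ B ≡ true → allF (λ i → not (isRep σ i) ∨ mono i) ≡ true
      bwd p = allF-intro (λ i → not (isRep σ i) ∨ mono i) λ i → ∨-introʳ (not (isRep σ i)) (mono-inv i)
        where
        ∨-introʳ : ∀ a {b} → b ≡ true → a ∨ b ≡ true
        ∨-introʳ true  _ = refl
        ∨-introʳ false e = e
        B-on : ∀ {i j} → i ⇝ j → B j ≡ B i
        B-on = ⇝-invariant B (invariantᵇ-sound σ B p)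
        mono-inv : ∀ i → mono i ≡ true
        mono-inv i with B i in e
        ... | true  = cong (_∨ isDCycle (complement A) σ i) (isDCycle-complete A i λ j i⇝j → trans (B-on i⇝j) e)
        ... | false = ∨-introʳ (isDCycle A σ i)
            (isDCycle-complete (complement A) i λ j i⇝j → cong not (trans (B-on i⇝j) e))

    -- On each cycle where `B` holds, ℓ = (ℓ - 1) + 1; summing ℓ counts the vertices with `B`. The
    -- additive form avoids truncated subtraction.
    φ-count : invariantᵇ σ B ≡ true → φ A σ ℕ.+ cnt (λ r → isRep σ r ∧ B r) ≡ cnt B
    φ-count p = ℤP.+-injective (begin
      pos (φ A σ) + pos (cnt (λ r → isRep σ r ∧ B r))
        ≡⟨ cong₂ _+_ pos-φ (pos-cnt (λ r → isRep σ r ∧ B r)) ⟩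
      ∑ (allFin n) (λ r → ⟦ isRep σ r ⟧ * (⟦ isDCycle A σ r ⟧ * pos (pred (orbitLen σ r))))
          + ∑ (allFin n) (λ r → ⟦ isRep σ r ∧ B r ⟧)
        ≡⟨ ∑-+ (allFin n) (λ r → ⟦ isRep σ r ⟧ * (⟦ isDCycle A σ r ⟧ * pos (pred (orbitLen σ r))))
            (λ r → ⟦ isRep σ r ∧ B r ⟧) ⟨
      ∑ (allFin n) (λ r → ⟦ isRep σ r ⟧ * (⟦ isDCycle A σ r ⟧ * pos (pred (orbitLen σ r))) + ⟦ isRep σ r ∧ B r ⟧)
        ≡⟨ ∑-cong (allFin n) local ⟩
      ∑ (allFin n) (λ r → ⟦ isRep σ r ⟧ * (pos (orbitLen σ r) * ⟦ B r ⟧))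
        ≡⟨ ∑-orbits (λ i → ⟦ B i ⟧) (λ i → cong ⟦_⟧ (B-inv i)) ⟨
      ∑ (allFin n) (λ i → ⟦ B i ⟧)
        ≡⟨ pos-cnt B ⟨
      pos (cnt B) ∎)
      where
      B-inv = invariantᵇ-sound σ B p
      pos-φ : pos (φ A σ) ≡ ∑ (allFin n) (λ r → ⟦ isRep σ r ⟧ * (⟦ isDCycle A σ r ⟧ * pos (pred (orbitLen σ r))))
      pos-φ = trans (pos-sum-map (λ i → pred (orbitLen σ i))
          (filter (λ i → isDCycle A σ i Bool.≟ true) (cycleReps σ)))
             (trans (∑-filter (isDCycle A σ) (cycleReps σ) (λ i → pos (pred (orbitLen σ i))))
                    (∑-filter (isRep σ) (allFin n) (λ i → ⟦ isDCycle A σ i ⟧ * pos (pred (orbitLen σ i)))))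
      DCycle≡B : ∀ r → isDCycle A σ r ≡ B r
      DCycle≡B r = ⇔⇒≡ (λ e → isDCycle-sound A e (0 , refl))
          (λ e → isDCycle-complete A r λ j r⇝j → trans (⇝-invariant B B-inv r⇝j) e)
      pos-ℓ : ∀ r → pos (orbitLen σ r) ≡ pos (pred (orbitLen σ r)) + 1ℤ
      pos-ℓ r with orbitLen σ r | orbitLen-spec r
      ... | suc ℓ | _ = cong pos (ℕP.+-comm 1 ℓ)
      local : ∀ r → ⟦ isRep σ r ⟧ * (⟦ isDCycle A σ r ⟧ * pos (pred (orbitLen σ r))) + ⟦ isRep σ r ∧ B r ⟧
          ≡ ⟦ isRep σ r ⟧ * (pos (orbitLen σ r) * ⟦ B r ⟧)
      local r = begin
        ⟦ isRep σ r ⟧ * (⟦ isDCycle A σ r ⟧ * pos (pred (orbitLen σ r))) + ⟦ isRep σ r ∧ B r ⟧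
          ≡⟨ cong₂ (λ b z → ⟦ isRep σ r ⟧ * (⟦ b ⟧ * pos (pred (orbitLen σ r))) + z) (DCycle≡B r)
              (⟦∧⟧ (isRep σ r) (B r)) ⟩
        ⟦ isRep σ r ⟧ * (⟦ B r ⟧ * pos (pred (orbitLen σ r))) + ⟦ isRep σ r ⟧ * ⟦ B r ⟧
          ≡⟨ solve 3 (λ x y l → x :* (y :* l) :+ x :* y := x :* ((l :+ con 1ℤ) :* y)) refl ⟦ isRep σ r ⟧ ⟦ B r ⟧
              (pos (pred (orbitLen σ r))) ⟩
        ⟦ isRep σ r ⟧ * ((pos (pred (orbitLen σ r)) + 1ℤ) * ⟦ B r ⟧)
          ≡⟨ cong (λ z → ⟦ isRep σ r ⟧ * (z * ⟦ B r ⟧)) (pos-ℓ r) ⟨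
        ⟦ isRep σ r ⟧ * (pos (orbitLen σ r) * ⟦ B r ⟧) ∎
        where open +-*-Solver using (solve; _:=_; _:*_; _:+_; con)

    Z≡sign : Z σ B ≡ ⟦ inSDD A σ ⟧ * -1ℤ ^ φ A σ
    Z≡sign = ⟦⟧*-cong {invariantᵇ σ B} (sym inSDD≡invariant) λ p → begin
      alt B * alt K
        ≡⟨ cong (_* alt K) (trans (alt≡-1^ B) (cong (-1ℤ ^_) (sym (φ-count p)))) ⟩
      -1ℤ ^ (φ A σ ℕ.+ cnt K) * alt K
        ≡⟨ cong (_* alt K) (trans (ℤP.^-distribˡ-+-* -1ℤ (φ A σ) (cnt K)) (cong (-1ℤ ^ φ A σ *_) (sym (alt≡-1^ K)))) ⟩
      -1ℤ ^ φ A σ * alt K * alt K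
        ≡⟨ trans (*-assoc (-1ℤ ^ φ A σ) (alt K) (alt K)) (trans (cong (-1ℤ ^ φ A σ *_) (alt² K)) (*-identityʳ _)) ⟩
      -1ℤ ^ φ A σ ∎
      where
      K : Fin n → Bool
      K r = isRep σ r ∧ B r

  Z-twist : ∀ {k} (A : Digraph n) (f : Fin n → Fin k) →
    cycleWeight (twist A f) σ ≡ ⟦ constantᵇ σ f ⟧ * cycleWeight A σ
  Z-twist A f = trans (⟦⟧*-cong {invariantᵇ σ T} inv
      (λ p → cong₂ _*_ (alt-cong (T≗ p)) (alt-cong λ r → cong (isRep σ r ∧_) (T≗ p r))))
    (trans (cong (_* (alt B * alt (λ r → isRep σ r ∧ B r))) (⟦∧⟧ (constantᵇ σ f) (invariantᵇ σ B)))
           (*-assoc ⟦ constantᵇ σ f ⟧ ⟦ invariantᵇ σ B ⟧ (alt B * alt (λ r → isRep σ r ∧ B r))))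
    where
    T B : Fin n → Bool
    T i = twist A f i (σ i)
    B i = A i (σ i)
    -- One step of `σ` gives one inequality between the colours of `i` and `σ i`; the rest of the
    -- cycle, from `σ i` back to `i`, gives the reverse one.
    level : invariantᵇ σ T ≡ true → ∀ i → f (σ i) ≡ f i
    level p i with T i in e
    ... | true  = toℕ-injective (ℕP.≤-antisym (down (0 , refl)) (descend (⇝-sym (1 , refl))))
      where
      down : ∀ {j} → i ⇝ j → toℕ (f (σ j)) ≤ toℕ (f j)
      down {j} i⇝j = twist-true A f j (σ j) (trans (⇝-invariant T (invariantᵇ-sound σ T p) i⇝j) e)
      descend : ∀ {j} → σ i ⇝ j → toℕ (f j) ≤ toℕ (f (σ i))
      descend (zero  , refl) = ℕP.≤-refl
      descend (suc m , refl) = ℕP.≤-trans (down (⇝-trans (1 , refl) (m , refl))) (descend (m , refl))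
    ... | false = toℕ-injective (ℕP.≤-antisym (ascend (⇝-sym (1 , refl))) (up (0 , refl)))
      where
      up : ∀ {j} → i ⇝ j → toℕ (f j) ≤ toℕ (f (σ j))
      up {j} i⇝j = twist-false A f j (σ j) (trans (⇝-invariant T (invariantᵇ-sound σ T p) i⇝j) e)
      ascend : ∀ {j} → σ i ⇝ j → toℕ (f (σ i)) ≤ toℕ (f j)
      ascend (zero  , refl) = ℕP.≤-refl
      ascend (suc m , refl) = ℕP.≤-trans (ascend (m , refl)) (up (⇝-trans (1 , refl) (m , refl)))
    T≗ : invariantᵇ σ T ≡ true → T ≗ B
    T≗ p i = twist-level A f i (σ i) (level p i)
    inv : invariantᵇ σ T ≡ constantᵇ σ f ∧ invariantᵇ σ B
    inv = ⇔⇒≡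
      (λ p → ∧-intro (allF-intro (λ i → f (σ i) == f i) λ i → ==-complete (level p i))
                     (invariantᵇ-complete σ B λ i → trans (sym (T≗ p (σ i)))
                         (trans (invariantᵇ-sound σ T p i) (T≗ p i))))
      (λ q → let f-inv = constantᵇ-sound σ f (proj₁ (∧-elim q)) ; B-inv = invariantᵇ-sound σ B (proj₂ (∧-elim {constantᵇ σ f} q)) in
        invariantᵇ-complete σ T λ i → trans (twist-level A f (σ i) (σ (σ i)) (f-inv (σ i)))
            (trans (B-inv i) (sym (twist-level A f i (σ i) (f-inv i)))))

  module _ (k : ℕ) (α : Fin k → ℕ) where

    private
      reps = cycleReps σ
      -- The test inside `coeffP`, with the list of parts replaced by a function on `Fin L`, so that
      -- the index set can be moved from the positions of `cycleType σ` to those of `reps`.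
      okP : (L : ℕ) → (Fin L → ℕ) → (Fin L → Fin k) → Bool
      okP L l c = allF (λ v → sum (map l (filter (λ j → (c j == v) Bool.≟ true) (allFin L))) ≡ᵇ α v)
      colourings : (L : ℕ) → (Fin L → ℕ) → ℤ
      colourings L l = ∑ (allFuns L k) (λ c → ⟦ okP L l c ⟧)

      okP≡ : ∀ {L} (l : Fin L → ℕ) c {m} (g : Fin m → Fin k) →
        (∀ v → ∑ (allFin L) (λ j → ⟦ c j == v ⟧ * pos (l j)) ≡ ∑ (allFin m) (λ i → ⟦ g i == v ⟧)) →
        okP L l c ≡ content α g
      okP≡ {L} l c g e = allF-cong _ _ λ v → cong (_≡ᵇ α v) (ℤP.+-injective (begin
        pos (sum (map l (filter (λ j → (c j == v) Bool.≟ true) (allFin L))))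
          ≡⟨ pos-sum-map l (filter (λ j → (c j == v) Bool.≟ true) (allFin L)) ⟩
        ∑ (filter (λ j → (c j == v) Bool.≟ true) (allFin L)) (λ j → pos (l j))
          ≡⟨ ∑-filter (λ j → c j == v) (allFin L) (λ j → pos (l j)) ⟩
        ∑ (allFin L) (λ j → ⟦ c j == v ⟧ * pos (l j))
          ≡⟨ trans (e v) (sym (pos-countF (λ i → g i == v))) ⟩
        pos (countF (λ i → g i == v)) ∎))

      -- Needed because the length of a mapped list equals that of the original only
      -- propositionally; the cast disappears once the equation is matched with `refl`.
      colourings-cong : ∀ {L L′} (eq : L ≡ L′) (l : Fin L → ℕ) (l′ : Fin L′ → ℕ) →
          (∀ i → l i ≡ l′ (cast eq i)) → colourings L l ≡ colourings L′ l′
      colourings-cong {L} refl l l′ e = ∑-cong (allFuns L k) λ c → cong ⟦_⟧ (allF-cong _ _ λ v →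
        cong (λ xs → sum xs ≡ᵇ α v) (map-cong (λ i → trans (e i) (cong l′ (cast-is-id refl i)))
            (filter (λ j → (c j == v) Bool.≟ true) (allFin L))))

      reps-unique : Unique reps
      reps-unique = filter⁺ (λ i → isRep σ i Bool.≟ true) (allFin⁺ n)
      ρ∈reps : ∀ i → ρ i ∈ reps
      ρ∈reps i = ∈-filter⁺ (λ i → isRep σ i Bool.≟ true) (∈-allFin (ρ i)) (isRep-ρ i)
      idx : Fin n → Fin (length reps)
      idx i = index (ρ∈reps i)
      rep : Fin (length reps) → Fin n
      rep = lookup reps
      rep-idx : ∀ i → rep (idx i) ≡ ρ i
      rep-idx i = sym (lookup-index (ρ∈reps i))
      isRep-rep : ∀ j → isRep σ (rep j) ≡ true
      isRep-rep j = proj₂ (∈-filter⁻ (λ i → isRep σ i Bool.≟ true) {xs = allFin n} (∈-lookup {xs = reps} j))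
      idx-unique : ∀ {i j} → rep j ⇝ i → idx i ≡ j
      idx-unique {i} {j} r⇝i = lookup-injective reps-unique (idx i) j
          (trans (rep-idx i) (sym (ρ-unique (isRep-rep j) r⇝i)))

    -- Choosing one variable per cycle amounts to colouring the vertices constantly on cycles: `idx`
    -- sends a vertex to its cycle and `rep` picks the representative. A part of size ℓ contributes
    -- ℓ to the exponent, just as its ℓ equally coloured vertices do, by `∑-orbits`.
    coeffP-cycleType : pos (coeffP (cycleType σ) k α) ≡ ∑ (allFuns n k) (λ f → ⟦ content α f ⟧ * ⟦ constantᵇ σ f ⟧)
    coeffP-cycleType = begin
      pos (coeffP (cycleType σ) k α)
        ≡⟨ pos-length-filter (okP (length (cycleType σ)) (lookup (cycleType σ))) (allFuns (length (cycleType σ)) k) ⟩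
      colourings (length (cycleType σ)) (lookup (cycleType σ))
        ≡⟨ colourings-cong (length-map (orbitLen σ) reps) (lookup (cycleType σ)) ℓ (lookup-map (orbitLen σ) reps) ⟩
      colourings (length reps) ℓ
        ≡⟨ ∑-cong 𝓒 (λ c → *-identityʳ ⟦ okP (length reps) ℓ c ⟧) ⟨
      ∑ 𝓒 (λ c → ⟦ okP (length reps) ℓ c ⟧ * 1ℤ)
        ≡⟨ ∑-bijection {xs = 𝓒} {_≗ᵇ_} (allFuns-enumerates (length reps) k) {allFuns n k} {_≗ᵇ_}
            (allFuns-enumerates n k)
             (okP (length reps) ℓ) (λ f → content α f ∧ constantᵇ σ f) (_∘ idx) (_∘ rep) fwd bwd ⟩
      ∑ (allFuns n k) (λ f → ⟦ content α f ∧ constantᵇ σ f ⟧ * 1ℤ)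
        ≡⟨ ∑-cong (allFuns n k) (λ f → trans (*-identityʳ _) (⟦∧⟧ (content α f) (constantᵇ σ f))) ⟩
      ∑ (allFuns n k) (λ f → ⟦ content α f ⟧ * ⟦ constantᵇ σ f ⟧) ∎
      where
      𝓒 = allFuns (length reps) k
      ℓ : Fin (length reps) → ℕ
      ℓ = orbitLen σ ∘ rep
      weights : ∀ c f → (∀ i → f (σ i) ≡ f i) → c ≗ f ∘ rep → okP (length reps) ℓ c ≡ content α f
      weights c f inv e = okP≡ ℓ c f λ v → begin
        ∑ (allFin (length reps)) (λ j → ⟦ c j == v ⟧ * pos (ℓ j))
          ≡⟨ ∑-cong (allFin (length reps)) (λ j → trans (cong (λ x → ⟦ x == v ⟧ * pos (ℓ j)) (e j))
              (*-comm ⟦ f (rep j) == v ⟧ (pos (ℓ j)))) ⟩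
        ∑ (allFin (length reps)) (λ j → pos (orbitLen σ (rep j)) * ⟦ f (rep j) == v ⟧)
          ≡⟨ ∑-lookup reps (λ r → pos (orbitLen σ r) * ⟦ f r == v ⟧) ⟩
        ∑ reps (λ r → pos (orbitLen σ r) * ⟦ f r == v ⟧)
          ≡⟨ ∑-filter (isRep σ) (allFin n) (λ r → pos (orbitLen σ r) * ⟦ f r == v ⟧) ⟩
        ∑ (allFin n) (λ r → ⟦ isRep σ r ⟧ * (pos (orbitLen σ r) * ⟦ f r == v ⟧))
          ≡⟨ ∑-orbits (λ i → ⟦ f i == v ⟧) (λ i → cong (λ x → ⟦ x == v ⟧) (inv i)) ⟨
        ∑ (allFin n) (λ i → ⟦ f i == v ⟧) ∎
      fwd : ∀ c f → okP (length reps) ℓ c ≡ true → f ≗ᵇ (c ∘ idx) ≡ true →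
        (content α f ∧ constantᵇ σ f ≡ true × c ≗ᵇ (f ∘ rep) ≡ true) × 1ℤ ≡ 1ℤ
      fwd c f p q = (∧-intro (trans (sym (weights c f inv c≗)) p)
          (allF-intro (λ i → f (σ i) == f i) λ i → ==-complete (inv i)) , ≗ᵇ-complete c (f ∘ rep) c≗) , refl
        where
        f≗ = ≗ᵇ-sound f (c ∘ idx) q
        inv : ∀ i → f (σ i) ≡ f i
        inv i = trans (f≗ (σ i)) (trans (cong c
            (idx-unique (⇝-trans (subst (_⇝ i) (sym (rep-idx i)) (⇝-sym (⇝ρ i))) (1 , refl)))) (sym (f≗ i)))
        c≗ : c ≗ f ∘ rep
        c≗ j = sym (trans (f≗ (rep j)) (cong c (idx-unique (0 , refl))))
      bwd : ∀ c f → content α f ∧ constantᵇ σ f ≡ true → c ≗ᵇ (f ∘ rep) ≡ true →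
        okP (length reps) ℓ c ≡ true × f ≗ᵇ (c ∘ idx) ≡ true
      bwd c f p q = trans (weights c f inv c≗) (proj₁ (∧-elim p)) ,
        ≗ᵇ-complete f (c ∘ idx) λ i → sym (trans (c≗ (idx i)) (trans (cong f (rep-idx i)) (⇝-invariant f inv (⇝ρ i))))
        where
        c≗ = ≗ᵇ-sound c (f ∘ rep) q
        inv = constantᵇ-sound σ f (proj₂ (∧-elim {content α f} p))

-- Membership in `inSDD` and the sign merge into `cycleWeight A σ`; the constancy condition from the
-- power sums is then absorbed by passing from `A` to `twist A f`.
coeffRHS≡∑ : ∀ {n} (A : Digraph n) k α →
  coeffRHS A k α ≡ ∑ (allFuns n k) (λ f → ⟦ content α f ⟧ * ∑ (perms n) (cycleWeight (twist A f)))
coeffRHS≡∑ {n} A k α = begin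
  coeffRHS A k α
    ≡⟨ sumℤ-map term (filter (λ σ → inSDD A σ Bool.≟ true) (perms n)) ⟩
  ∑ (filter (λ σ → inSDD A σ Bool.≟ true) (perms n)) term
    ≡⟨ ∑-filter (inSDD A) (perms n) term ⟩
  ∑ (perms n) (λ σ → ⟦ inSDD A σ ⟧ * term σ)
    ≡⟨ ∑-perms-cong n expand ⟩
  ∑ (perms n) (λ σ → ∑ 𝓕 (λ f → ⟦ content α f ⟧ * cycleWeight (twist A f) σ))
    ≡⟨ ∑-comm (perms n) 𝓕 (λ σ f → ⟦ content α f ⟧ * cycleWeight (twist A f) σ) ⟩
  ∑ 𝓕 (λ f → ∑ (perms n) (λ σ → ⟦ content α f ⟧ * cycleWeight (twist A f) σ))
    ≡⟨ ∑-cong 𝓕 (λ f → ∑-*ˡ (perms n) ⟦ content α f ⟧ (cycleWeight (twist A f))) ⟩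
  ∑ 𝓕 (λ f → ⟦ content α f ⟧ * ∑ (perms n) (cycleWeight (twist A f))) ∎
  where
  𝓕 = allFuns n k
  term : (Fin n → Fin n) → ℤ
  term σ = -1ℤ ^ φ A σ * pos (coeffP (cycleType σ) k α)
  expand : ∀ σ → Inj σ → ⟦ inSDD A σ ⟧ * term σ ≡ ∑ 𝓕 (λ f → ⟦ content α f ⟧ * cycleWeight (twist A f) σ)
  expand σ inj = begin
    ⟦ inSDD A σ ⟧ * (-1ℤ ^ φ A σ * pos (coeffP (cycleType σ) k α))
      ≡⟨ *-assoc ⟦ inSDD A σ ⟧ (-1ℤ ^ φ A σ) _ ⟨
    ⟦ inSDD A σ ⟧ * -1ℤ ^ φ A σ * pos (coeffP (cycleType σ) k α)
      ≡⟨ cong₂ _*_ (sym (Z≡sign σ inj A)) (coeffP-cycleType σ inj k α) ⟩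
    cycleWeight A σ * ∑ 𝓕 (λ f → ⟦ content α f ⟧ * ⟦ constantᵇ σ f ⟧)
      ≡⟨ ∑-*ˡ 𝓕 (cycleWeight A σ) (λ f → ⟦ content α f ⟧ * ⟦ constantᵇ σ f ⟧) ⟨
    ∑ 𝓕 (λ f → cycleWeight A σ * (⟦ content α f ⟧ * ⟦ constantᵇ σ f ⟧))
      ≡⟨ ∑-cong 𝓕 (λ f → trans (rotate (cycleWeight A σ) ⟦ content α f ⟧ ⟦ constantᵇ σ f ⟧)
          (cong (⟦ content α f ⟧ *_) (sym (Z-twist σ inj A f)))) ⟩
    ∑ 𝓕 (λ f → ⟦ content α f ⟧ * cycleWeight (twist A f) σ) ∎
    where
    open +-*-Solver using (solve; _:=_; _:*_)
    rotate : ∀ x y z → x * (y * z) ≡ y * (z * x)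
    rotate = solve 3 (λ x y z → x :* (y :* z) := y :* (z :* x)) refl

theorem1p31 : (n : ℕ) (A : Digraph n) (k : ℕ) (α : Fin k → ℕ) →
    coeffU A k α ≡ coeffRHS A k α
theorem1p31 n A k α = begin
  coeffU A k α
    ≡⟨ coeffU≡∑ A k α ⟩
  ∑ (allFuns n k) (λ f → ⟦ content α f ⟧ * ∑ (perms n) (path (twist A f)))
    ≡⟨ ∑-cong (allFuns n k) (λ f → cong (⟦ content α f ⟧ *_)
        (insertive-unique path-insertive cycleWeight-insertive (twist A f))) ⟩
  ∑ (allFuns n k) (λ f → ⟦ content α f ⟧ * ∑ (perms n) (cycleWeight (twist A f)))
    ≡⟨ coeffRHS≡∑ A k α ⟨
  coeffRHS A k α ∎
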